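{- As $x\to\infty$, the estimate $$\sum_{a,b\le x} H(a,b)<x^{25/13+o(1)}$$ holds, where the sum runs over all pairs $(a,b)$ of positive integers with $a\le x$ and $b\le x$.
   Context: A Heron triangle is a (non-degenerate) triangle whose three side lengths and whose area are all positive integers. For positive integers $a,b$, $H(a,b)$ denotes the number of distinct positive integers $c$ such that $a,b,c$ are the side lengths of a Heron triangle. The notation $o(1)$ stands for a function of $x$ tending to $0$ as $x\to\infty$. -}

module Defs where

open import Data.Nat using (ℕ; suc; _+_; _*_; _∸_; _^_; _≤_; _<_; s≤s; _≟_; _<?_)
open import Data.Nat.Properties
  using (≤-trans; ≤-reflexive; m≤n*m; m≤m*n; anyUpTo?)
open import Data.Integer using (+_; -[1+_])
open import Data.Rational.Unnormalised as ℚ using (ℚᵘ; 0ℚᵘ; ↥_; ↧ₙ_)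
open import Data.List using (List; length; map; upTo; applyUpTo; filter)
open import Data.Nat.ListAction using (sum)
open import Data.List.Membership.Propositional using (_∈_)
open import Data.List.Membership.Propositional.Properties
  using (∈-filter⁺; ∈-filter⁻; ∈-upTo⁺)
open import Data.List.Relation.Unary.Unique.Propositional using (Unique)
open import Data.List.Relation.Unary.Unique.Propositional.Properties
  using (filter⁺; upTo⁺)
open import Data.Product using (∃-syntax; _×_; _,_; proj₂)
open import Function.Bundles using (_⇔_; mk⇔)
open import Relation.Binary.PropositionalEquality using (_≡_)
open import Relation.Nullary.Decidable using (Dec; map′; _×-dec_)

-- Heron's formula in the form 16·area² = (a+b+c)(b+c−a)(a+c−b)(a+b−c).
-- The truncated subtractions are exact whenever the triangle inequalities hold,
-- which is the only situation in which this is used.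
sixteenAreaSquared : ℕ → ℕ → ℕ → ℕ
sixteenAreaSquared a b c = (a + b + c) * (b + c ∸ a) * (a + c ∸ b) * (a + b ∸ c)

HasPositiveIntegerArea : ℕ → ℕ → ℕ → Set
HasPositiveIntegerArea a b c =
  ∃[ A ] (0 < A × 16 * (A * A) ≡ sixteenAreaSquared a b c)

record IsHeron (a b c : ℕ) : Set where
  constructor mkIsHeron
  field
    0<a   : 0 < a
    0<b   : 0 < b
    0<c   : 0 < c
    a<b+c : a < b + c
    b<a+c : b < a + c
    c<a+b : c < a + b
    area  : HasPositiveIntegerArea a b c

area? : ∀ a b c → Dec (HasPositiveIntegerArea a b c)
area? a b c = map′ (λ (A , _ , p) → A , p) (λ (A , p) → A , bound A p , p)
  (anyUpTo? (λ A → (0 <? A) ×-dec (16 * (A * A) ≟ s)) (suc s))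
  where
  s = sixteenAreaSquared a b c
  bound : ∀ A → 0 < A × 16 * (A * A) ≡ s → A < suc s
  bound (suc A) (_ , eq) = s≤s (≤-trans (m≤m*n (suc A) (suc A))
    (≤-trans (m≤n*m (suc A * suc A) 16) (≤-reflexive eq)))

isHeron? : ∀ a b c → Dec (IsHeron a b c)
isHeron? a b c = map′
  (λ (p , q , r , s , t , u , v) → mkIsHeron p q r s t u v)
  (λ (mkIsHeron p q r s t u v) → p , q , r , s , t , u , v)
  (0 <? a ×-dec 0 <? b ×-dec 0 <? c ×-dec
   a <? b + c ×-dec b <? a + c ×-dec c <? a + b ×-dec area? a b c)

-- The search range c < a + b loses nothing, by the triangle inequality
-- (see ∈-heronThirdSides).
heronThirdSides : ℕ → ℕ → List ℕ
heronThirdSides a b = filter (isHeron? a b) (upTo (a + b))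

∈-heronThirdSides : ∀ a b c → c ∈ heronThirdSides a b ⇔ IsHeron a b c
∈-heronThirdSides a b c = mk⇔
  (λ c∈ → proj₂ (∈-filter⁻ (isHeron? a b) {xs = upTo (a + b)} c∈))
  (λ h → ∈-filter⁺ (isHeron? a b) (∈-upTo⁺ (IsHeron.c<a+b h)) h)

heronThirdSides-unique : ∀ a b → Unique (heronThirdSides a b)
heronThirdSides-unique a b = filter⁺ (isHeron? a b) (upTo⁺ (a + b))

H : ℕ → ℕ → ℕ
H a b = length (heronThirdSides a b)

-- f 1 + f 2 + ⋯ + f x
sumTo : ℕ → (ℕ → ℕ) → ℕ
sumTo x f = sum (map f (applyUpTo suc x))

heronSum : ℕ → ℕ
heronSum x = sumTo x λ a → sumTo x λ b → H a b

-- S < x ^ r for a rational exponent r = p / q with q > 0, meaning S ^ q < x ^ p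
-- (both sides raised to the power q). When p = − n < 0 this is S ^ q * x ^ n < 1.
-- It does not depend on the fraction representing r. Intended for x > 0.
_<_^ᵘ_ : ℕ → ℕ → ℚᵘ → Set
S < x ^ᵘ r with ↥ r
... | + p      = S ^ (↧ₙ r) < x ^ p
... | -[1+ n ] = S ^ (↧ₙ r) * x ^ suc n < 1

TendsToZero : (ℕ → ℚᵘ) → Set
TendsToZero o = ∀ ε → 0ℚᵘ ℚ.< ε → ∃[ N ] (∀ x → N ≤ x → ℚ.∣ o x ∣ ℚ.< ε)

{-# OPTIONS --safe #-}
module Submission where

-- With X = s − a, Y = s − b, Z = s − c and s = X + Y + Z, Heron's formula says that s X Y Z is a
-- square. Two facts give the saving over the trivial exponent 2.
-- (1) If X and s are fixed, then Y + Z = s − X and s X Y Z is a square. After removing g = gcd (Y , Z)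
-- we have Y = g k p², Z = g l q² with k and l among divisors of s X (s − X)², so k p² + l q² = (s − X) / g
-- with coprime summands. Such a definite form represents e at most 3 τ(e) times. Hence there are
-- O(T⁴) possibilities, where T bounds the divisor function and T is smaller than any power of x.
-- (2) Write s = f r² with f dividing X Y Z. If r ≤ M and the gcds of s with X, Y, Z are all ≤ M, then
-- f ≤ M³ and s ≤ M⁵. So s ≤ M⁵, or r² ∣ s with r > M, or s shares a divisor > M with one of X, Y, Z;
-- this leaves O(x² / M + M¹⁰) pairs such as (X , s).
-- For M ≈ x^(1/6) the total is x^(11/6 + ε), and 11/6 < 25/13, so o = 0 works.

open import Defs
open import Data.Product using (∃-syntax; _×_; _,_; proj₁; proj₂)

-- Cardinality bounds by duplicate-free lists.

module Counting where

  open import Data.Nat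
  open import Data.Nat.Properties
  open import Data.List using (List; []; _∷_; length)
  open import Data.List.Membership.Propositional using (_∈_)
  open import Data.List.Relation.Unary.Any using (here; there)
  open import Data.List.Relation.Unary.All as All using (All; []; _∷_)
  open import Data.List.Relation.Unary.AllPairs using ([]; _∷_)
  open import Data.List.Relation.Unary.Unique.Propositional using (Unique)
  open import Data.List.Relation.Binary.Pointwise using (Pointwise; []; _∷_; Pointwise-length)
  open import Data.Sum using (_⊎_; inj₁; inj₂)
  open import Function using (_∘_)
  open import Relation.Binary.PropositionalEquality
  open import Relation.Nullary using (contradiction)

  -- Bounding the duplicate-free lists makes sense for any predicate, without enumerating or
  -- deciding `P`.
  AtMost : {A : Set} → ℕ → (A → Set) → Set
  AtMost n P = ∀ xs → Unique xs → All P xs → length xs ≤ n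

  Σ< : ℕ → (ℕ → ℕ) → ℕ
  Σ< zero    f = 0
  Σ< (suc n) f = Σ< n f + f n

  module _ {A : Set} where

    private variable
      P Q : A → Set
      c m n : ℕ

    AtMost-⇒ : (∀ {x} → P x → Q x) → AtMost n Q → AtMost n P
    AtMost-⇒ P⇒Q Q≤n xs u all = Q≤n xs u (All.map P⇒Q all)

    AtMost-≤ : m ≤ n → AtMost m P → AtMost n P
    AtMost-≤ m≤n P≤m xs u all = ≤-trans (P≤m xs u all) m≤n

    AtMost-1 : (∀ {x y} → P x → P y → x ≡ y) → AtMost 1 P
    AtMost-1 P-unique []          _                 _             = z≤n
    AtMost-1 P-unique (x ∷ [])    _                 _             = ≤-refl
    AtMost-1 P-unique (x ∷ y ∷ _) ((x≢y ∷ _) ∷ _) (px ∷ py ∷ _) =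
      contradiction (P-unique px py) x≢y

    -- The empty list meets every bound, so one element with `P` may be assumed at hand. Later
    -- counts take base points and positivity facts from it.
    AtMost-given : (∀ {x} → P x → AtMost n P) → AtMost n P
    AtMost-given P≤n []         _ _              = z≤n
    AtMost-given P≤n xs@(_ ∷ _) u all@(px ∷ _) = P≤n px xs u all

    -- The two inclusions carry uniqueness over from `xs` to `ys` and `zs`.
    data Split (P Q : A → Set) (xs : List A) : Set where
      split : ∀ ys zs → (∀ {x} → x ∈ ys → x ∈ xs) → (∀ {x} → x ∈ zs → x ∈ xs) →
              Unique ys → Unique zs → All P ys → All Q zs →
              length xs ≡ length ys + length zs → Split P Q xs

    splitList : ∀ {xs} → Unique xs → All (λ x → P x ⊎ Q x) xs → Split P Q xs
    splitList [] [] = split [] [] (λ ()) (λ ()) [] [] [] [] refl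
    splitList (x∉ ∷ u) (pq ∷ all) with splitList u all | pq
    ... | split ys zs ys⊆ zs⊆ uy uz py qz len | inj₁ p =
      split (_ ∷ ys) zs (λ { (here e) → here e ; (there i) → there (ys⊆ i) }) (there ∘ zs⊆)
        (All.tabulate (All.lookup x∉ ∘ ys⊆) ∷ uy) uz (p ∷ py) qz (cong suc len)
    ... | split ys zs ys⊆ zs⊆ uy uz py qz len | inj₂ q =
      split ys (_ ∷ zs) (there ∘ ys⊆) (λ { (here e) → here e ; (there i) → there (zs⊆ i) })
        uy (All.tabulate (All.lookup x∉ ∘ zs⊆) ∷ uz) py (q ∷ qz)
        (trans (cong suc len) (sym (+-suc (length ys) (length zs))))

    AtMost-⊎ : AtMost m P → AtMost n Q → AtMost (m + n) (λ x → P x ⊎ Q x)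
    AtMost-⊎ P≤m Q≤n xs u all with splitList u all
    ... | split ys zs _ _ uy uz py qz len =
      subst (_≤ _) (sym len) (+-mono-≤ (P≤m ys uy py) (Q≤n zs uz qz))

    AtMost-∈ : {K : Set} {Q : K → A → Set} (ks : List K) →
               (∀ {k} → k ∈ ks → AtMost n (Q k)) →
               AtMost (length ks * n) (λ x → ∃[ k ] (k ∈ ks × Q k x))
    AtMost-∈ []       _   []      _ _                   = z≤n
    AtMost-∈ []       _   (_ ∷ _) _ ((_ , () , _) ∷ _)
    AtMost-∈ (k ∷ ks) Q≤n = AtMost-⇒
      (λ { (_ , here refl , q) → inj₁ q ; (j , there i , q) → inj₂ (j , i , q) })
      (AtMost-⊎ (Q≤n (here refl)) (AtMost-∈ ks (Q≤n ∘ there)))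

    AtMost-Σ< : {Q : ℕ → A → Set} (f : ℕ → ℕ) → (∀ k → AtMost (f k) (Q k)) →
                ∀ n → AtMost (Σ< n f) (λ x → ∃[ k ] (k < n × Q k x))
    AtMost-Σ< f Q≤f zero    []      _ _                  = z≤n
    AtMost-Σ< f Q≤f zero    (_ ∷ _) _ ((_ , () , _) ∷ _)
    AtMost-Σ< {Q} f Q≤f (suc n) = AtMost-⇒
      (λ (k , k<1+n , q) → case-≤ k q (m≤n⇒m<n∨m≡n (≤-pred k<1+n)))
      (AtMost-⊎ (AtMost-Σ< f Q≤f n) (Q≤f n))
      where
      case-≤ : ∀ k {x} → Q k x → k < n ⊎ k ≡ n → (∃[ k ] (k < n × Q k x)) ⊎ Q n x
      case-≤ k q (inj₁ k<n)  = inj₁ (k , k<n , q)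
      case-≤ k q (inj₂ refl) = inj₂ q

    AtMost-< : {Q : ℕ → A → Set} → ∀ n → (∀ k → AtMost c (Q k)) →
               AtMost (n * c) (λ x → ∃[ k ] (k < n × Q k x))
    AtMost-< {c} n Q≤c = subst (λ N → AtMost N _) (Σ<-const n) (AtMost-Σ< (λ _ → c) Q≤c n)
      where
      Σ<-const : ∀ n → Σ< n (λ _ → c) ≡ n * c
      Σ<-const zero    = refl
      Σ<-const (suc n) = trans (+-comm _ c) (cong (c +_) (Σ<-const n))

  module _ {A B : Set} {P : A → Set} {Q : B → Set} {_~_ : A → B → Set} where

    -- A relation stands in place of a function because the partner of `x` may be extracted from the
    -- proof of `P x`. Injectivity keeps the list of partners duplicate-free.
    AtMost-~ : ∀ {n} → (∀ {x} → P x → ∃[ y ] (Q y × x ~ y)) →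
               (∀ {x x′ y} → x ~ y → x′ ~ y → x ≡ x′) → AtMost n Q → AtMost n P
    AtMost-~ total injective Q≤n xs u all with related all
      where
      related : ∀ {xs} → All P xs → ∃[ ys ] (Pointwise _~_ xs ys × All Q ys)
      related [] = [] , [] , []
      related (p ∷ ps) with total p | related ps
      ... | y , q , x~y | ys , xs~ys , qs = y ∷ ys , x~y ∷ xs~ys , q ∷ qs
    ... | ys , xs~ys , qs = subst (_≤ _) (sym (Pointwise-length xs~ys)) (Q≤n ys (unique u xs~ys) qs)
      where
      fresh : ∀ {x y xs ys} → x ~ y → All (x ≢_) xs → Pointwise _~_ xs ys → All (y ≢_) ys
      fresh x~y []          []              = []
      fresh x~y (x≢x′ ∷ ns) (x′~y′ ∷ xs~ys) =
        (λ { refl → x≢x′ (injective x~y x′~y′) }) ∷ fresh x~y ns xs~ys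
      unique : ∀ {xs ys} → Unique xs → Pointwise _~_ xs ys → Unique ys
      unique []        []            = []
      unique (x∉ ∷ u) (x~y ∷ xs~ys) = fresh x~y x∉ xs~ys ∷ unique u xs~ys

-- The divisor function grows more slowly than any power.

module DivisorBound where

  open Counting
  open import Data.Nat
  open import Data.Nat.Properties
  open import Data.Nat.Divisibility
  open import Data.Nat.DivMod using (_/_; _%_; m≡m%n+[m/n]*n; m%n<n; m/n*n≤m)
  open import Data.Nat.Coprimality using (Coprime; coprime-divisor)
  open import Data.Nat.Primality
  open import Data.Nat.Primality.Factorisation using (factorise; module PrimeFactorisation)
  open import Data.Nat.ListAction using (product)
  open import Data.Nat.ListAction.Properties using (∈⇒∣product)
  open import Data.Nat.Induction using (<-rec)
  open import Data.List using (List; []; _∷_; length; filter; upTo)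
  open import Data.List.Membership.Propositional using (_∈_)
  open import Data.List.Membership.Propositional.Properties using (∈-filter⁺; ∈-filter⁻; ∈-upTo⁺)
  open import Data.List.Relation.Unary.All as All using (All; []; _∷_)
  open import Data.List.Relation.Unary.Unique.Propositional.Properties using (filter⁺; upTo⁺)
  open import Data.Sum using (inj₁; inj₂)
  open import Relation.Binary.PropositionalEquality
  open import Relation.Nullary using (contradiction; ¬_; yes; no)

  divisors : ℕ → List ℕ
  divisors n = filter (_∣? n) (upTo (suc n))

  τ : ℕ → ℕ
  τ n = length (divisors n)

  ∈-divisors : ∀ {d n} → 0 < n → d ∣ n → d ∈ divisors n
  ∈-divisors {n = suc n} _ d∣n = ∈-filter⁺ (_∣? suc n) (∈-upTo⁺ (s≤s (∣⇒≤ d∣n))) d∣n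

  divisors-∣ : ∀ {d n} → d ∈ divisors n → d ∣ n
  divisors-∣ {n = n} d∈ = proj₂ (∈-filter⁻ (_∣? n) {xs = upTo (suc n)} d∈)

  AtMost⇒τ≤ : ∀ {n N} → AtMost N (_∣ n) → τ n ≤ N
  AtMost⇒τ≤ {n} most = most (divisors n) (filter⁺ (_∣? n) (upTo⁺ (suc n))) (All.tabulate divisors-∣)

  prime∤⇒coprime : ∀ {p d} → Prime p → ¬ p ∣ d → Coprime d p
  prime∤⇒coprime p-prime p∤d (k∣d , k∣p) with prime⇒irreducible p-prime k∣p
  ... | inj₁ k≡1  = k≡1
  ... | inj₂ refl = contradiction k∣d p∤d

  -- Factors `p` are stripped one at a time: if `p` does not divide `d`, coprimality removes it and
  -- leaves `i` alone; otherwise it cancels on both sides and `i` grows by one.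
  ∣prime^* : ∀ {p d} → Prime p → ∀ e {m} → d ∣ p ^ e * m →
             ∃[ i ] (i < suc e × ∃[ d′ ] (d′ ∣ m × d ≡ p ^ i * d′))
  ∣prime^* {d = d} _ zero d∣m =
    0 , z<s , d , subst (d ∣_) (*-identityˡ _) d∣m , sym (*-identityˡ d)
  ∣prime^* {p} {d} p-prime (suc e) {m} d∣ with p ∣? d
  ... | no p∤d =
    let i , i≤e , rest = ∣prime^* p-prime e
          (coprime-divisor (prime∤⇒coprime p-prime p∤d) (subst (d ∣_) (*-assoc p (p ^ e) m) d∣))
    in  i , m<n⇒m<1+n i≤e , rest
  ... | yes (divides q refl) =
    let i , i≤e , d′ , d′∣m , q≡ = ∣prime^* p-prime e
          (*-cancelˡ-∣ p {{prime⇒nonZero p-prime}}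
            (subst₂ _∣_ (*-comm q p) (*-assoc p (p ^ e) m) d∣))
    in  suc i , s≤s i≤e , d′ , d′∣m ,
        trans (*-comm q p) (trans (cong (p *_) q≡) (sym (*-assoc p (p ^ i) d′)))

  τ[p^e*m]≤ : ∀ {p} → Prime p → ∀ e {m} → 0 < m → τ (p ^ e * m) ≤ suc e * τ m
  τ[p^e*m]≤ {p} p-prime e {m} 0<m = subst (λ N → τ (p ^ e * m) ≤ suc e * N) (*-identityʳ (τ m))
    (AtMost⇒τ≤ (AtMost-⇒
      (λ d∣ → let i , i≤e , d′ , d′∣m , d≡ = ∣prime^* p-prime e d∣
              in  i , i≤e , d′ , ∈-divisors 0<m d′∣m , d≡)
      (AtMost-< {Q = λ i d → ∃[ d′ ] (d′ ∈ divisors m × d ≡ p ^ i * d′)} (suc e) (λ i →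
        AtMost-∈ {Q = λ d′ d → d ≡ p ^ i * d′} (divisors m)
          (λ _ → AtMost-1 λ x≡ y≡ → trans x≡ (sym y≡))))))

  ^-distribʳ-* : ∀ k m n → (m * n) ^ k ≡ m ^ k * n ^ k
  ^-distribʳ-* zero    m n = refl
  ^-distribʳ-* (suc k) m n = trans (cong (m * n *_) (^-distribʳ-* k m n))
    ([m*n]*[o*p]≡[m*o]*[n*p] m n (m ^ k) (n ^ k))

  split-power : ∀ q → 1 < q → ∀ n → 0 < n → ∃[ e ] ∃[ m ] (n ≡ q ^ e * m × ¬ q ∣ m)
  split-power q 1<q = <-rec _ step
    where
    step : ∀ n → (∀ {k} → k < n → 0 < k → ∃[ e ] ∃[ m ] (k ≡ q ^ e * m × ¬ q ∣ m)) →
           0 < n → ∃[ e ] ∃[ m ] (n ≡ q ^ e * m × ¬ q ∣ m)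
    step n rec 0<n with q ∣? n
    ... | no q∤n = 0 , n , sym (*-identityˡ n) , q∤n
    ... | yes (divides k@(suc _) refl) =
      let e , m , k≡ , q∤m = rec (m<m*n k q 1<q) z<s
      in  suc e , m , trans (*-comm k q) (trans (cong (q *_) k≡) (sym (*-assoc q (q ^ e) m))) , q∤m

  n<2^n : ∀ n → n < 2 ^ n
  n<2^n zero    = z<s
  n<2^n (suc n) = ≤-trans (+-mono-≤ (m^n>0 2 n) (n<2^n n))
    (≤-reflexive (cong (2 ^ n +_) (sym (+-identityʳ (2 ^ n)))))

  -- Write e = r + jK with r < K; then 1 + e ≤ K (j + 1) ≤ K 2 ^ j.
  poly≤exp : ∀ K .{{_ : NonZero K}} e → suc e ^ K ≤ K ^ K * 2 ^ e
  poly≤exp K e = begin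
    suc e ^ K           ≤⟨ ^-monoˡ-≤ K 1+e≤ ⟩
    (K * 2 ^ j) ^ K     ≡⟨ ^-distribʳ-* K K (2 ^ j) ⟩
    K ^ K * (2 ^ j) ^ K ≡⟨ cong (K ^ K *_) (^-*-assoc 2 j K) ⟩
    K ^ K * 2 ^ (j * K) ≤⟨ *-monoʳ-≤ (K ^ K) (^-monoʳ-≤ 2 (m/n*n≤m e K)) ⟩
    K ^ K * 2 ^ e       ∎
    where
    open ≤-Reasoning
    j = e / K
    1+e≤ : suc e ≤ K * 2 ^ j
    1+e≤ = begin
      suc e                     ≡⟨ cong suc (m≡m%n+[m/n]*n e K) ⟩
      suc (e % K) + j * K       ≤⟨ +-monoˡ-≤ (j * K) (m%n<n e K) ⟩
      suc j * K                 ≤⟨ *-monoˡ-≤ K (n<2^n j) ⟩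
      2 ^ j * K                 ≡⟨ *-comm (2 ^ j) K ⟩
      K * 2 ^ j                 ∎

  module _ (K : ℕ) .{{_ : NonZero K}} where

    open ≤-Reasoning

    -- Each further prime at most doubles τ. This costs 2 ^ K in the K-th power, and a prime of at
    -- least that size pays for it.
    τ[product]^K≤ : ∀ {ps} → All Prime ps → All (2 ^ K ≤_) ps → τ (product ps) ^ K ≤ product ps
    τ[product]^K≤ []                    []           = ≤-reflexive (^-zeroˡ K)
    τ[product]^K≤ {p ∷ ps} (pr ∷ prs) (2^K≤p ∷ ≤s) = begin
      τ (p * product ps) ^ K       ≤⟨ ^-monoˡ-≤ K τ≤ ⟩
      (2 * τ (product ps)) ^ K     ≡⟨ ^-distribʳ-* K 2 (τ (product ps)) ⟩
      2 ^ K * τ (product ps) ^ K   ≤⟨ *-mono-≤ 2^K≤p (τ[product]^K≤ prs ≤s) ⟩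
      p * product ps               ∎
      where
      τ≤ : τ (p * product ps) ≤ 2 * τ (product ps)
      τ≤ = subst (λ q → τ (q * product ps) ≤ 2 * τ (product ps)) (^-identityʳ p)
             (τ[p^e*m]≤ pr 1 (productOfPrimes≥1 prs))

    τ^K≤-rough : ∀ n → 0 < n → (2 ^ K) Rough n → τ n ^ K ≤ n
    τ^K≤-rough n 0<n rough = subst (λ n → τ n ^ K ≤ n) (sym isFactorisation)
      (τ[product]^K≤ factorsPrime (All.tabulate λ {p} p∈ →
        rough⇒≤ {{prime⇒nonTrivial (All.lookup factorsPrime p∈)}}
          (rough∧∣⇒rough rough (subst (p ∣_) (sym isFactorisation) (∈⇒∣product p∈)))))
      where open PrimeFactorisation (factorise n {{>-nonZero 0<n}})

    -- Downward induction on `q` from 2 ^ K, with `j` the distance to 2 ^ K. If `q` divides a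
    -- `q`-rough number it is prime, and splitting off q ^ e costs (e + 1) ^ K ≤ K ^ K q ^ e; so
    -- each `q` multiplies the constant by K ^ K.
    τ^K≤-from : ∀ j q → 1 < q → q + j ≡ 2 ^ K →
                ∃[ C ] (∀ n → 0 < n → q Rough n → τ n ^ K ≤ C * n)
    τ^K≤-from zero q 1<q q≡ = 1 , λ n 0<n rough →
      ≤-trans (τ^K≤-rough n 0<n (subst (_Rough n) (trans (sym (+-identityʳ q)) q≡) rough))
        (≤-reflexive (sym (*-identityˡ n)))
    τ^K≤-from (suc j) q 1<q q≡ with τ^K≤-from j (suc q) (m<n⇒m<1+n 1<q) (trans (sym (+-suc q j)) q≡)
    ... | C , rec = K ^ K * C , bound
      where
      bound : ∀ n → 0 < n → q Rough n → τ n ^ K ≤ K ^ K * C * n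
      bound n 0<n rough with q ∣? n
      ... | no q∤n = ≤-trans (rec n 0<n (∤⇒rough-suc q∤n rough))
                       (*-monoˡ-≤ n (m≤n*m C (K ^ K) {{m^n≢0 K K}}))
      ... | yes q∣n with split-power q 1<q n 0<n
      ... | e , zero  , n≡qᵉm , q∤m = contradiction (q ∣0) q∤m
      ... | e , m@(suc _) , refl , q∤m = begin
        τ (q ^ e * m) ^ K              ≤⟨ ^-monoˡ-≤ K (τ[p^e*m]≤ q-prime e z<s) ⟩
        (suc e * τ m) ^ K              ≡⟨ ^-distribʳ-* K (suc e) (τ m) ⟩
        suc e ^ K * τ m ^ K            ≤⟨ *-mono-≤ (≤-trans (poly≤exp K e) (*-monoʳ-≤ (K ^ K) (^-monoˡ-≤ e 1<q)))
                                            (rec m z<s (∤⇒rough-suc q∤m (rough∧∣⇒rough rough (n∣m*n (q ^ e))))) ⟩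
        K ^ K * q ^ e * (C * m)        ≡⟨ [m*n]*[o*p]≡[m*o]*[n*p] (K ^ K) (q ^ e) C m ⟩
        K ^ K * C * (q ^ e * m)        ∎
        where
        q-prime : Prime q
        q-prime = rough∧∣⇒prime {{n>1⇒nonTrivial 1<q}} rough q∣n

    -- In other words τ(n) = O(n^(1/K)). The induction is entered at 2, where roughness is
    -- automatic.
    τ-bound : ∃[ C ] (∀ n → 0 < n → τ n ^ K ≤ C * n)
    τ-bound with τ^K≤-from (2 ^ K ∸ 2) 2 ≤-refl (m+[n∸m]≡n (^-monoʳ-≤ 2 (>-nonZero⁻¹ K)))
    ... | C , bound = C , λ n 0<n → bound n 0<n 2-rough

-- Coprime representations by the form k p² + l q².

module BinaryForm where

  open Counting
  open DivisorBound
  open import Data.Nat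
  open import Data.Nat.Properties
  open import Data.Nat.Divisibility
  open import Data.Nat.DivMod using (_/_; m/n*n≡m)
  open import Data.Nat.GCD
  open import Data.Nat.LCM using (gcd*lcm; lcm-least)
  open import Data.Nat.Coprimality using (Coprime; coprime-divisor; coprime-/gcd)
  open import Data.Nat.Tactic.RingSolver using (solve-∀)
  open import Data.Integer as ℤ using (ℤ; +_; 0ℤ) renaming (∣_∣ to abs)
  import Data.Integer.Properties as ℤ
  import Data.Integer.Divisibility.Signed as ℤ∣
  import Data.Integer.Tactic.RingSolver as ℤ
  open import Data.List using (List; []; _∷_)
  open import Data.List.Membership.Propositional using (_∈_)
  open import Data.List.Relation.Unary.Any using (here; there)
  open import Relation.Binary.Definitions using (tri<; tri≈; tri>)
  open import Data.Sum using (_⊎_; inj₁; inj₂)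
  open import Relation.Binary.PropositionalEquality
  open import Relation.Nullary using (contradiction; ¬_)

  -- Coprime summands make `p`, `q` and `l` units modulo `e`, so that they cancel from
  -- divisibilities by divisors of `e`.
  record Represents (k l e p q : ℕ) : Set where
    constructor represents
    field
      0<p      : 0 < p
      0<q      : 0 < q
      equation : k * (p * p) + l * (q * q) ≡ e
      coprime  : Coprime (k * (p * p)) (l * (q * q))

    coprimeˡ : ∀ {r} → r ∣ k * (p * p) → Coprime e r
    coprimeˡ r∣ (d∣e , d∣r) = coprime
      (∣-trans d∣r r∣ , ∣m+n∣m⇒∣n (subst (_ ∣_) (sym equation) d∣e) (∣-trans d∣r r∣))

    coprimeʳ : ∀ {r} → r ∣ l * (q * q) → Coprime e r
    coprimeʳ r∣ (d∣e , d∣r) = coprime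
      (∣m+n∣m⇒∣n (subst (_ ∣_) (trans (sym equation) (+-comm _ (l * (q * q)))) d∣e) (∣-trans d∣r r∣) , ∣-trans d∣r r∣)

    coprime-p : Coprime e p
    coprime-p = coprimeˡ (∣n⇒∣m*n k (m∣m*n p))

    coprime-q : Coprime e q
    coprime-q = coprimeʳ (∣n⇒∣m*n l (m∣m*n q))

    coprime-l : Coprime e l
    coprime-l = coprimeʳ (m∣m*n (q * q))

    equationℤ : + k ℤ.* (+ p ℤ.* + p) ℤ.+ + l ℤ.* (+ q ℤ.* + q) ≡ + e
    equationℤ = trans (cong₂ ℤ._+_ (square k p) (square l q)) (cong +_ equation)
      where
      square : ∀ k p → + k ℤ.* (+ p ℤ.* + p) ≡ + (k * (p * p))
      square k p = trans (cong (+ k ℤ.*_) (sym (ℤ.pos-* p p))) (sym (ℤ.pos-* k (p * p)))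

  -- If (p , q) and (p₀ , q₀) both represent e, then l cross⁻ cross⁺ = e (p₀² − p²).
  cross⁻ cross⁺ : ℕ × ℕ → ℕ × ℕ → ℤ
  cross⁻ (p , q) (p′ , q′) = + q ℤ.* + p′ ℤ.- + q′ ℤ.* + p
  cross⁺ (p , q) (p′ , q′) = + q ℤ.* + p′ ℤ.+ + q′ ℤ.* + p

  coprime-∣ : ∀ {d e r} → d ∣ e → Coprime e r → Coprime d r
  coprime-∣ d∣e c (k∣d , k∣r) = c (∣-trans k∣d d∣e , k∣r)

  -- With d = gcd (e , m), the quotient e / d is coprime to m / d and hence divides `n`.
  ∣*⇒split : ∀ e m n → 0 < e → e ∣ m * n → ∃[ d ] ∃[ e′ ] (e ≡ e′ * d × d ∣ m × e′ ∣ n)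
  ∣*⇒split e m n 0<e e∣mn = d , e / d , sym (m/n*n≡m (gcd[m,n]∣m e m)) , gcd[m,n]∣n e m ,
    coprime-divisor (coprime-/gcd e m)
      (*-cancelʳ-∣ d (subst₂ _∣_ (sym (m/n*n≡m (gcd[m,n]∣m e m)))
        (trans (cong (_* n) (sym (m/n*n≡m (gcd[m,n]∣n e m)))) (swap (m / d) d n)) e∣mn))
    where
    d = gcd e m
    instance
      d≢0 : NonZero d
      d≢0 = ≢-nonZero (gcd[m,n]≢0 e m (inj₁ (≢-sym (<⇒≢ 0<e))))
    swap : ∀ a b c → a * b * c ≡ a * c * b
    swap = solve-∀

  multiple<double : ∀ {m n o} → n * m ≡ o → o < n + n → o ≡ 0 ⊎ o ≡ n
  multiple<double {zero} {n} nm≡o _ = inj₁ (trans (sym nm≡o) (*-zeroʳ n))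
  multiple<double {suc zero} {n} nm≡o _ = inj₂ (trans (sym nm≡o) (*-identityʳ n))
  multiple<double {suc (suc m)} {n} refl o<2n = contradiction
    (subst (_≤ n * suc (suc m)) (trans (*-comm n 2) (cong (λ k → n + k) (+-identityʳ n)))
      (*-monoʳ-≤ n (s≤s (s≤s z≤n)))) (<⇒≱ o<2n)

  abs≡⇒≡± : ∀ {i n} → abs i ≡ n → i ≡ + n ⊎ i ≡ ℤ.- + n
  abs≡⇒≡± {+ n}        refl = inj₁ refl
  abs≡⇒≡± {ℤ.-[1+ n ]} refl = inj₂ refl

  pos-cross⁻ : ∀ p q p′ q′ → cross⁻ (p , q) (p′ , q′) ≡ q * p′ ℤ.⊖ q′ * p
  pos-cross⁻ p q p′ q′ = trans (sym (cong₂ ℤ._-_ (ℤ.pos-* q p′) (ℤ.pos-* q′ p)))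
    (ℤ.m-n≡m⊖n (q * p′) (q′ * p))

  module _ {k l e : ℕ} (0<k : 0 < k) (0<l : 0 < l) where

    module _ {p q p₀ q₀} (r : Represents k l e p q) (r₀ : Represents k l e p₀ q₀) where
      private
        module X  = Represents r
        module X₀ = Represents r₀

      -- `l` is coprime to `e` and drops out of the identity for `l cross⁻ cross⁺`.
      e∣cross : e ∣ abs (cross⁻ (p , q) (p₀ , q₀)) * abs (cross⁺ (p , q) (p₀ , q₀))
      e∣cross = coprime-divisor X.coprime-l
        (subst (e ∣_)
          (trans (ℤ.abs-* (+ l) _) (cong (l *_) (ℤ.abs-* (cross⁻ (p , q) (p₀ , q₀)) _)))
          (ℤ∣.∣⇒∣ᵤ {+ e} (ℤ∣.divides (+ p₀ ℤ.* + p₀ ℤ.- + p ℤ.* + p) identity)))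
        where
        expand : ∀ k l p q p₀ q₀ →
          l ℤ.* ((q ℤ.* p₀ ℤ.- q₀ ℤ.* p) ℤ.* (q ℤ.* p₀ ℤ.+ q₀ ℤ.* p)) ≡
          (k ℤ.* (p ℤ.* p) ℤ.+ l ℤ.* (q ℤ.* q)) ℤ.* (p₀ ℤ.* p₀) ℤ.-
          (k ℤ.* (p₀ ℤ.* p₀) ℤ.+ l ℤ.* (q₀ ℤ.* q₀)) ℤ.* (p ℤ.* p)
        expand = ℤ.solve-∀
        collect : ∀ e a b → e ℤ.* a ℤ.- e ℤ.* b ≡ (a ℤ.- b) ℤ.* e
        collect = ℤ.solve-∀
        identity = trans (expand (+ k) (+ l) (+ p) (+ q) (+ p₀) (+ q₀))
          (trans (cong₂ (λ a b → a ℤ.* (+ p₀ ℤ.* + p₀) ℤ.- b ℤ.* (+ p ℤ.* + p))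
                   X.equationℤ X₀.equationℤ)
            (collect (+ e) (+ p₀ ℤ.* + p₀) (+ p ℤ.* + p)))

    p²<e : ∀ {p q} → Represents k l e p q → p * p < e
    p²<e {p} {q} r = ≤-<-trans (m≤n*m (p * p) k {{>-nonZero 0<k}})
      (subst (k * (p * p) <_) equation (m<m+n _ (*-mono-≤ 0<l (*-mono-≤ 0<q 0<q))))
      where open Represents r

    q²<e : ∀ {p q} → Represents k l e p q → q * q < e
    q²<e {p} {q} r = ≤-<-trans (m≤n*m (q * q) l {{>-nonZero 0<l}})
      (subst (l * (q * q) <_) equation (m<n+m _ (*-mono-≤ 0<k (*-mono-≤ 0<p 0<p))))
      where open Represents r

    q*p′<e : ∀ {p q p′ q′} → Represents k l e p q → Represents k l e p′ q′ → q * p′ < e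
    q*p′<e {q = q} {p′} r r′ with ≤-total q p′
    ... | inj₁ q≤p′ = ≤-<-trans (*-monoˡ-≤ p′ q≤p′) (p²<e r′)
    ... | inj₂ p′≤q = ≤-<-trans (*-monoʳ-≤ q p′≤q) (q²<e r)

    abs[cross⁻]<e : ∀ {p q p′ q′} → Represents k l e p q → Represents k l e p′ q′ →
                abs (cross⁻ (p , q) (p′ , q′)) < e
    abs[cross⁻]<e {p} {q} {p′} {q′} r r′ = subst (λ i → abs i < e) (sym (pos-cross⁻ p q p′ q′))
      (≤-<-trans (ℤ.∣m⊝n∣≤m⊔n (q * p′) (q′ * p)) (⊔-lub (q*p′<e r r′) (q*p′<e r′ r)))

    represents-mono : ∀ {p q p′ q′} → Represents k l e p q → Represents k l e p′ q′ →
                      p < p′ → ¬ q < q′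
    represents-mono {p} {q} {p′} {q′} r r′ p<p′ q<q′ = contradiction
      (trans (Represents.equation r) (sym (Represents.equation r′)))
      (<⇒≢ (+-mono-< (*-monoʳ-< k {{>-nonZero 0<k}} (*-mono-< p<p′ p<p′))
                     (*-monoʳ-< l {{>-nonZero 0<l}} (*-mono-< q<q′ q<q′))))

    -- For divisors `d` and `d′` of `e`, this says that the ratio q / p is q₀ / p₀ modulo `d` and -
    -- q₀ / p₀ modulo `d′`.
    InClass : (d d′ p₀ q₀ : ℕ) → ℕ × ℕ → Set
    InClass d d′ p₀ q₀ (p , q) = Represents k l e p q ×
      d ∣ abs (cross⁻ (p , q) (p₀ , q₀)) × d′ ∣ abs (cross⁺ (p , q) (p₀ , q₀))

    -- Within a class e divides twice the determinant, which is smaller than 2e in absolute value;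
    -- the factor 2 appears because d and d′ may both be even.
    e∣2*cross⁻ : ∀ {d d′ p₀ q₀ x y} → Represents k l e p₀ q₀ → e ≡ d′ * d →
                    InClass d d′ p₀ q₀ x → InClass d d′ p₀ q₀ y →
                    e ∣ 2 * abs (cross⁻ x y)
    e∣2*cross⁻ {d} {d′} {p₀} {q₀} {p , q} {p′ , q′} r₀ e≡ (r , d∣⁻ , d′∣⁺) (r′ , d∣⁻′ , d′∣⁺′) =
      -- Here e = d d′ = gcd · lcm. Both `d` and `d′` divide p₀ v, hence `v`, and so does their lcm;
      -- their gcd divides cross⁻ + cross⁺ = 2 q p₀, hence 2.
      subst (_∣ 2 * v) (trans (gcd*lcm d d′) (trans (*-comm d d′) (sym e≡)))
        (*-pres-∣ gcd∣2 (lcm-least (divides-v d∣e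
            (ℤ∣.∣m∣n⇒∣m-n (scale p′ d∣⁻) (scale p d∣⁻′)) id⁻)
          (divides-v d′∣e (ℤ∣.∣m∣n⇒∣m-n (scale p′ d′∣⁺) (scale p d′∣⁺′)) id⁺)))
      where
      v = abs (cross⁻ (p , q) (p′ , q′))
      d∣e : d ∣ e
      d∣e = divides d′ e≡
      d′∣e : d′ ∣ e
      d′∣e = divides d (trans e≡ (*-comm d′ d))
      scale : ∀ {c i} n → c ∣ abs i → + c ℤ∣.∣ + n ℤ.* i
      scale n c∣i = ℤ∣.∣n⇒∣m*n (+ n) (ℤ∣.∣ᵤ⇒∣ c∣i)
      divides-v : ∀ {c i} → c ∣ e → + c ℤ∣.∣ i →
                  i ≡ + p₀ ℤ.* cross⁻ (p , q) (p′ , q′) → c ∣ v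
      divides-v {c} c∣e c∣i i≡ = coprime-divisor (coprime-∣ c∣e (Represents.coprime-p r₀))
        (subst (c ∣_) (trans (cong abs i≡) (ℤ.abs-* (+ p₀) (cross⁻ (p , q) (p′ , q′)))) (ℤ∣.∣⇒∣ᵤ c∣i))
      id⁻ = identity (+ p) (+ q) (+ p′) (+ q′) (+ p₀) (+ q₀)
        where
        identity : ∀ p q p′ q′ p₀ q₀ →
          p′ ℤ.* (q ℤ.* p₀ ℤ.- q₀ ℤ.* p) ℤ.- p ℤ.* (q′ ℤ.* p₀ ℤ.- q₀ ℤ.* p′) ≡
          p₀ ℤ.* (q ℤ.* p′ ℤ.- q′ ℤ.* p)
        identity = ℤ.solve-∀
      id⁺ = identity (+ p) (+ q) (+ p′) (+ q′) (+ p₀) (+ q₀)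
        where
        identity : ∀ p q p′ q′ p₀ q₀ →
          p′ ℤ.* (q ℤ.* p₀ ℤ.+ q₀ ℤ.* p) ℤ.- p ℤ.* (q′ ℤ.* p₀ ℤ.+ q₀ ℤ.* p′) ≡
          p₀ ℤ.* (q ℤ.* p′ ℤ.- q′ ℤ.* p)
        identity = ℤ.solve-∀
      gcd∣2 : gcd d d′ ∣ 2
      gcd∣2 = coprime-divisor (coprime-∣ gcd∣e (Represents.coprime-q r))
        (coprime-divisor (coprime-∣ gcd∣e (Represents.coprime-p r₀))
          (subst (gcd d d′ ∣_) (trans (cong abs (identity (+ p) (+ q) (+ p₀) (+ q₀)))
              (trans (ℤ.abs-* (+ p₀) _) (cong (p₀ *_) (ℤ.abs-* (+ q) (+ 2)))))
            (ℤ∣.∣⇒∣ᵤ (ℤ∣.∣m∣n⇒∣m+n (ℤ∣.∣ᵤ⇒∣ {+ gcd d d′} {cross⁻ (p , q) (p₀ , q₀)} (∣-trans (gcd[m,n]∣m d d′) d∣⁻))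
                                    (ℤ∣.∣ᵤ⇒∣ {+ gcd d d′} {cross⁺ (p , q) (p₀ , q₀)} (∣-trans (gcd[m,n]∣n d d′) d′∣⁺))))))
        where
        gcd∣e : gcd d d′ ∣ e
        gcd∣e = ∣-trans (gcd[m,n]∣m d d′) d∣e
        identity : ∀ p q p₀ q₀ →
          (q ℤ.* p₀ ℤ.- q₀ ℤ.* p) ℤ.+ (q ℤ.* p₀ ℤ.+ q₀ ℤ.* p) ≡ p₀ ℤ.* (q ℤ.* + 2)
        identity = ℤ.solve-∀

    module _ {p q : ℕ} (0<p : 0 < p) (0<q : 0 < q) where

      exchange : ∀ p₁ q₁ p₂ q₂ → cross⁻ (p , q) (p₁ , q₁) ≡ cross⁻ (p , q) (p₂ , q₂) →
                 q * p₁ + q₂ * p ≡ q * p₂ + q₁ * p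
      exchange p₁ q₁ p₂ q₂ cross≡ = ℤ.+-injective
        (trans (cong₂ ℤ._+_ (ℤ.pos-* q p₁) (ℤ.pos-* q₂ p))
          (trans (move (+ q ℤ.* + p₁) (+ q₁ ℤ.* + p) (+ q ℤ.* + p₂) (+ q₂ ℤ.* + p) cross≡)
            (sym (cong₂ ℤ._+_ (ℤ.pos-* q p₂) (ℤ.pos-* q₁ p)))))
        where
        regroup : ∀ a b d → a ℤ.+ d ≡ (a ℤ.- b) ℤ.+ (b ℤ.+ d)
        regroup = ℤ.solve-∀
        regroup′ : ∀ b c d → (c ℤ.- d) ℤ.+ (b ℤ.+ d) ≡ c ℤ.+ b
        regroup′ = ℤ.solve-∀
        move : ∀ a b c d → a ℤ.- b ≡ c ℤ.- d → a ℤ.+ d ≡ c ℤ.+ b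
        move a b c d eq = trans (regroup a b d) (trans (cong (ℤ._+ (b ℤ.+ d)) eq) (regroup′ b c d))

      q-mono : ∀ p₁ q₁ p₂ q₂ → cross⁻ (p , q) (p₁ , q₁) ≡ cross⁻ (p , q) (p₂ , q₂) →
               p₁ < p₂ → q₁ < q₂
      q-mono p₁ q₁ p₂ q₂ cross≡ p₁<p₂ = ≰⇒> λ q₂≤q₁ → <⇒≢
        (+-mono-<-≤ (*-monoʳ-< q {{>-nonZero 0<q}} p₁<p₂) (*-monoˡ-≤ p q₂≤q₁)) (exchange p₁ q₁ p₂ q₂ cross≡)

      -- Points with the same determinant against (p , q) lie on a line of positive slope. The form
      -- strictly increases along it, so the value `e` is taken at most once.
      represents-unique : ∀ {y z} → Represents k l e (proj₁ y) (proj₂ y) → Represents k l e (proj₁ z) (proj₂ z) →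
                          cross⁻ (p , q) y ≡ cross⁻ (p , q) z → y ≡ z
      represents-unique {p₁ , q₁} {p₂ , q₂} r₁ r₂ cross≡ with <-cmp p₁ p₂
      ... | tri< p₁<p₂ _ _ = contradiction (q-mono p₁ q₁ p₂ q₂ cross≡ p₁<p₂) (represents-mono r₁ r₂ p₁<p₂)
      ... | tri> _ _ p₂<p₁ = contradiction (q-mono p₂ q₂ p₁ q₁ (sym cross≡) p₂<p₁) (represents-mono r₂ r₁ p₂<p₁)
      ... | tri≈ _ refl _ = cong (p₁ ,_) (sym (*-cancelʳ-≡ q₂ q₁ p {{>-nonZero 0<p}}
                              (+-cancelˡ-≡ (q * p₁) _ _ (exchange p₁ q₁ p₁ q₂ cross≡))))

    -- Fix a member `x`. For any member `y`, twice the determinant of `x` and `y` is a multiple of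
    -- `e` below 2e in absolute value, so it is 0, e or -e, and each value determines `y`.
    AtMost-class : ∀ d d′ {p₀ q₀} → Represents k l e p₀ q₀ → e ≡ d′ * d →
                   AtMost 3 (InClass d d′ p₀ q₀)
    AtMost-class d d′ {p₀} {q₀} r₀ e≡ = AtMost-given λ {x} x∈@(rx , _) →
      AtMost-⇒ (λ {y} y∈@(ry , _) → _ , twice-cross⁻ x y x∈ y∈ , ry , refl)
        (AtMost-∈ {Q = λ w y → Represents k l e (proj₁ y) (proj₂ y) × + 2 ℤ.* cross⁻ x y ≡ w} values
          λ _ → AtMost-1 λ {y} {z} (ry , y≡) (rz , z≡) →
            represents-unique (Represents.0<p rx) (Represents.0<q rx) ry rz
              (ℤ.*-cancelˡ-≡ (+ 2) (cross⁻ x y) (cross⁻ x z) (trans y≡ (sym z≡))))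
      where
      values : List ℤ
      values = 0ℤ ∷ + e ∷ ℤ.- + e ∷ []
      twice-cross⁻ : ∀ x y → InClass d d′ p₀ q₀ x → InClass d d′ p₀ q₀ y → + 2 ℤ.* cross⁻ x y ∈ values
      twice-cross⁻ x y x∈@(rx , _) y∈@(ry , _) with e∣2*cross⁻ r₀ e≡ x∈ y∈
      ... | divides c 2v≡ce with multiple<double (trans (*-comm e c) (sym 2v≡ce))
              (subst (λ m → abs (cross⁻ x y) + m < e + e) (sym (+-identityʳ _))
                (+-mono-< (abs[cross⁻]<e rx ry) (abs[cross⁻]<e rx ry)))
      ... | inj₁ 2v≡0 = here (ℤ.∣i∣≡0⇒i≡0 (trans (ℤ.abs-* (+ 2) (cross⁻ x y)) 2v≡0))
      ... | inj₂ 2v≡e with abs≡⇒≡± (trans (ℤ.abs-* (+ 2) (cross⁻ x y)) 2v≡e)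
      ... | inj₁ ≡e  = there (here ≡e)
      ... | inj₂ ≡-e = there (there (here ≡-e))

    -- Against a fixed representation `x₀`, every other one distributes `e` over the two cross
    -- factors as d′ d. There are τ e choices of `d`, each giving one class.
    AtMost-Represents : AtMost (τ e * 3) (λ (p , q) → Represents k l e p q)
    AtMost-Represents = AtMost-given λ {x₀} r₀ → AtMost-⇒
      (λ {x} r →
        let d , d′ , e≡ , d∣⁻ , d′∣⁺ = ∣*⇒split e (abs (cross⁻ x x₀)) (abs (cross⁺ x x₀)) (0<e r) (e∣cross r r₀)
        in  d , ∈-divisors (0<e r) (divides d′ e≡) , d′ , e≡ , r , d∣⁻ , d′∣⁺)
      (AtMost-∈ {Q = λ d x → ∃[ d′ ] (e ≡ d′ * d × InClass d d′ (proj₁ x₀) (proj₂ x₀) x)} (divisors e)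
        -- The cofactor `d′` is read off from one member; the others share it because `d` is
        -- positive.
        λ {d} _ → AtMost-given λ (d′ , e≡ , r , _) → AtMost-⇒
          (λ (d″ , e≡′ , c) → subst (λ d′ → InClass d d′ (proj₁ x₀) (proj₂ x₀) _)
            (*-cancelʳ-≡ d″ d′ d {{>-nonZero (0<d d d′ (0<e r) e≡)}} (trans (sym e≡′) e≡)) c)
          (AtMost-class d d′ r₀ e≡))
      where
      0<e : ∀ {p q} → Represents k l e p q → 0 < e
      0<e r = ≤-trans z<s (p²<e r)
      0<d : ∀ d d′ → 0 < e → e ≡ d′ * d → 0 < d
      0<d zero d′ 0<e e≡ = contradiction (trans (sym (*-zeroʳ d′)) (sym e≡)) (<⇒≢ 0<e)
      0<d (suc _) _ _ _ = z<s

-- Pairs (Y , Z) with given sum for which D Y Z is a square.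

module TwoSummands where

  open Counting
  open DivisorBound
  open BinaryForm
  open import Data.Nat
  open import Data.Nat.Properties
  open import Data.Nat.Divisibility
  open import Data.Nat.DivMod using (_/_; m/n*n≡m)
  open import Data.Nat.GCD
  open import Data.Nat.Coprimality using (Coprime; coprime-divisor; coprime-/gcd) renaming (sym to coprime-sym)
  open import Data.Nat.Tactic.RingSolver using (solve-∀)
  open import Data.List.Membership.Propositional using (_∈_)
  open import Data.Sum using (inj₁)
  open import Relation.Binary.PropositionalEquality

  gcd-split : ∀ m n → 0 < m → ∃[ g ] ∃[ m′ ] ∃[ n′ ] (0 < g × m ≡ m′ * g × n ≡ n′ * g × Coprime m′ n′)
  gcd-split m n 0<m = g , m / g , n / g , >-nonZero⁻¹ g ,
    sym (m/n*n≡m (gcd[m,n]∣m m n)) , sym (m/n*n≡m (gcd[m,n]∣n m n)) , coprime-/gcd m n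
    where
    g = gcd m n
    instance
      g≢0 : NonZero g
      g≢0 = ≢-nonZero (gcd[m,n]≢0 m n (inj₁ (≢-sym (<⇒≢ 0<m))))

  ∣⇒0< : ∀ {m n} → 0 < n → m ∣ n → 0 < m
  ∣⇒0< {zero}  0<n 0∣n = subst (0 <_) (0∣⇒≡0 0∣n) 0<n
  ∣⇒0< {suc m} _   _   = z<s

  -- Cancelling g = gcd (m , A) leaves s n = α² g with `s` coprime to `α`. Hence `s` divides `g`,
  -- and the quotient is `f`.
  square-split : ∀ m n A → 0 < m → m * n ≡ A * A →
                 ∃[ f ] ∃[ s ] ∃[ t ] (m ≡ f * (s * s) × n ≡ f * (t * t))
  square-split m n A 0<m mn≡A² with gcd-split m A 0<m
  ... | g , s , α , 0<g , refl , refl , s⊥α with coprime-divisor s⊥α (coprime-divisor s⊥α s∣ααg)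
    where
    sn≡ααg : s * n ≡ α * (α * g)
    sn≡ααg = *-cancelʳ-≡ _ _ g {{>-nonZero 0<g}} (trans (left s n g) (trans mn≡A² (right α g)))
      where
      left : ∀ s n g → s * n * g ≡ s * g * n
      left = solve-∀
      right : ∀ α g → α * g * (α * g) ≡ α * (α * g) * g
      right = solve-∀
    s∣ααg : s ∣ α * (α * g)
    s∣ααg = subst (s ∣_) sn≡ααg (m∣m*n n)
  ... | divides f refl = f , s , α , left s f , *-cancelˡ-≡ _ _ (s * (f * s))
      {{>-nonZero 0<m}} (trans mn≡A² (right s f α))
    where
    left : ∀ s f → s * (f * s) ≡ f * (s * s)
    left = solve-∀
    right : ∀ s f α → α * (f * s) * (α * (f * s)) ≡ s * (f * s) * (f * (α * α))
    right = solve-∀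

  -- Applied with D = s X and a = s - X, these are the pairs that complete a given X and s.
  SplitsInto : ℕ → ℕ → ℕ × ℕ → Set
  SplitsInto D a (Y , Z) = 0 < Y × 0 < Z × Y + Z ≡ a × ∃[ A ] (D * (Y * Z) ≡ A * A)

  module _ {B T D a : ℕ} (τ≤T : ∀ n → 0 < n → n ≤ B → τ n ≤ T)
           (0<D : 0 < D) (0<a : 0 < a) (a≤B : a ≤ B) (N≤B : D * (a * a) ≤ B) where

    private
      N : ℕ
      N = D * (a * a)

      0<N : 0 < N
      0<N = *-mono-≤ 0<D (*-mono-≤ 0<a 0<a)

      Scaled : ℕ → ℕ → ℕ → ℕ → ℕ × ℕ → Set
      Scaled g k l e (Y , Z) = ∃[ x ] (Represents k l e (proj₁ x) (proj₂ x) ×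
        Y ≡ g * (k * (proj₁ x * proj₁ x)) × Z ≡ g * (l * (proj₂ x * proj₂ x)))

    AtMost-Scaled : ∀ {g k l e} → 0 < g → 0 < k → 0 < l → 0 < e → e ≤ B → AtMost (T * 3) (Scaled g k l e)
    AtMost-Scaled {g} {k} {l} {e} 0<g 0<k 0<l 0<e e≤B = AtMost-≤ (*-monoˡ-≤ 3 (τ≤T e 0<e e≤B))
      (AtMost-~ {_~_ = λ (Y , Z) (p , q) → Y ≡ g * (k * (p * p)) × Z ≡ g * (l * (q * q))}
        (λ p → p) (λ (Y≡ , Z≡) (Y′≡ , Z′≡) → cong₂ _,_ (trans Y≡ (sym Y′≡)) (trans Z≡ (sym Z′≡)))
        (AtMost-Represents 0<k 0<l))

    -- Since y · (z D g²) is a square, y = k p² and `k` divides z D g². As a divisor of `y` it is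
    -- coprime to `z`, so it divides D g² and therefore D a².
    squareCofactor-∣ : ∀ g y z A → g ∣ a → 0 < y → Coprime y z → D * (y * g * (z * g)) ≡ A * A →
                   ∃[ k ] ∃[ p ] (k ∣ N × y ≡ k * (p * p))
    squareCofactor-∣ g y z A g∣a 0<y y⊥z eq
      with square-split y (z * (D * (g * g))) A 0<y (trans (regroup y z g D) eq)
      where
      regroup : ∀ y z g D → y * (z * (D * (g * g))) ≡ D * (y * g * (z * g))
      regroup = solve-∀
    ... | k , p , t , y≡ , ≡kt² = k , p , ∣-trans
      (coprime-divisor (coprime-∣ k∣y y⊥z) (subst (k ∣_) (sym ≡kt²) (m∣m*n (t * t))))
      (*-monoʳ-∣ D (*-pres-∣ g∣a g∣a)) , y≡
      where
      k∣y : k ∣ y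
      k∣y = subst (k ∣_) (sym y≡) (m∣m*n (p * p))

    0<square : ∀ {k p} → 0 < k * (p * p) → 0 < p
    0<square {k} {zero}  0< = subst (0 <_) (*-zeroʳ k) 0<
    0<square {k} {suc p} 0< = z<s

    scaled : ∀ {x} → SplitsInto D a x →
             ∃[ g ] (g ∈ divisors a × ∃[ k ] (k ∈ divisors N × ∃[ l ] (l ∈ divisors N ×
               ∃[ e ] (a ≡ e * g × Scaled g k l e x))))
    scaled {Y , Z} (0<Y , 0<Z , Y+Z≡a , A , D*YZ≡A²) =
      let g , y , z , _ , Y≡ , Z≡ , y⊥z = gcd-split Y Z 0<Y
          g∣Y = divides y Y≡
          g∣Z = divides z Z≡
          g∣a = subst (g ∣_) Y+Z≡a (∣m∣n⇒∣m+n g∣Y g∣Z)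
          0<y = ∣⇒0< 0<Y (divides g (trans Y≡ (*-comm y g)))
          0<z = ∣⇒0< 0<Z (divides g (trans Z≡ (*-comm z g)))
          k , p , k∣N , y≡ = squareCofactor-∣ g y z A g∣a 0<y y⊥z
            (trans (cong (D *_) (sym (cong₂ _*_ Y≡ Z≡))) D*YZ≡A²)
          l , q , l∣N , z≡ = squareCofactor-∣ g z y A g∣a 0<z (coprime-sym y⊥z)
            (trans (cong (D *_) (trans (sym (cong₂ _*_ Z≡ Y≡)) (*-comm Z Y))) D*YZ≡A²)
      in  g , ∈-divisors 0<a g∣a , k , ∈-divisors 0<N k∣N , l , ∈-divisors 0<N l∣N ,
          y + z ,
          trans (sym Y+Z≡a) (trans (cong₂ _+_ Y≡ Z≡) (sym (*-distribʳ-+ g y z))) ,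
          (p , q) ,
          represents (0<square {k} (subst (0 <_) y≡ 0<y)) (0<square {l} (subst (0 <_) z≡ 0<z))
            (sym (cong₂ _+_ y≡ z≡)) (subst₂ Coprime y≡ z≡ y⊥z) ,
          trans Y≡ (trans (*-comm y g) (cong (g *_) y≡)) ,
          trans Z≡ (trans (*-comm z g) (cong (g *_) z≡))

    -- Three factors `T` count the choices of `g`, `k` and `l`; the fourth bounds τ e in the number
    -- of representations. The value e = a / g is determined by `g`.
    AtMost-SplitsInto : AtMost (T * (T * (T * (T * 3)))) (SplitsInto D a)
    AtMost-SplitsInto = AtMost-⇒ scaled
      (AtMost-≤ (*-monoˡ-≤ _ (τ≤T a 0<a a≤B)) (AtMost-∈ {Q = λ g x →
          ∃[ k ] (k ∈ divisors N × ∃[ l ] (l ∈ divisors N × ∃[ e ] (a ≡ e * g × Scaled g k l e x)))}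
          (divisors a) λ {g} g∈ →
      AtMost-≤ (*-monoˡ-≤ _ (τ≤T N 0<N N≤B)) (AtMost-∈ {Q = λ k x →
          ∃[ l ] (l ∈ divisors N × ∃[ e ] (a ≡ e * g × Scaled g k l e x))}
          (divisors N) λ {k} k∈ →
      AtMost-≤ (*-monoˡ-≤ _ (τ≤T N 0<N N≤B)) (AtMost-∈ {Q = λ l x → ∃[ e ] (a ≡ e * g × Scaled g k l e x)}
          (divisors N) λ {l} l∈ → fibre g k l (divisors-∣ g∈) (divisors-∣ k∈) (divisors-∣ l∈)))))
      where
      fibre : ∀ g k l → g ∣ a → k ∣ N → l ∣ N → AtMost (T * 3) (λ x → ∃[ e ] (a ≡ e * g × Scaled g k l e x))
      fibre g k l g∣a@(divides e a≡) k∣N l∣N = AtMost-⇒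
        (λ {x} (e′ , a≡′ , s) → subst (λ e → Scaled g k l e x)
          (*-cancelʳ-≡ e′ e g {{>-nonZero 0<g}} (trans (sym a≡′) a≡)) s)
        (AtMost-Scaled 0<g (∣⇒0< 0<N k∣N) (∣⇒0< 0<N l∣N) (∣⇒0< 0<a e∣a)
          (≤-trans (∣⇒≤ {{>-nonZero 0<a}} e∣a) a≤B))
        where
        0<g : 0 < g
        0<g = ∣⇒0< 0<a g∣a
        e∣a : e ∣ a
        e∣a = subst (e ∣_) (sym a≡) (m∣m*n g)

-- Counting Heron points through sparse pairs (X , s).

module HeronPoints where

  open Counting
  open DivisorBound
  open TwoSummands
  open import Data.Nat
  open import Data.Nat.Properties
  open import Data.Nat.Divisibility
  open import Data.Nat.DivMod using (_/_; m/n*n≤m; /-monoˡ-≤; m*n/n≡m; n/1≡n)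
  open import Data.Nat.GCD
  open import Data.Nat.Tactic.RingSolver using (solve-∀)
  open import Data.Sum using (_⊎_; inj₁; inj₂)
  open import Relation.Binary.PropositionalEquality
  open import Relation.Nullary using (contradiction; yes; no)

  *≤⇒≤/ : ∀ {m o} n .{{_ : NonZero n}} → m * n ≤ o → m ≤ o / n
  *≤⇒≤/ {m} {o} n mn≤o = subst (_≤ o / n) (m*n/n≡m m n) (/-monoˡ-≤ n mn≤o)

  -- 1 / (h + 1)² ≤ 1 / h − 1 / (h + 1); rounding down is harmless since ⌊ ⌋ is superadditive.
  telescope-step : ∀ {w n} h .{{_ : NonZero h}} → w * (suc h * suc h) ≤ n → w + n / suc h ≤ n / h
  telescope-step {w} {n} h w≤ = *≤⇒≤/ h (*-cancelʳ-≤ _ _ (suc h) (begin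
    (w + q) * h * suc h                ≡⟨ expand w q h ⟩
    w * (h * suc h) + q * suc h * h    ≤⟨ +-mono-≤ (≤-trans (*-monoʳ-≤ w (*-monoˡ-≤ (suc h) (n≤1+n h))) w≤)
                                                   (*-monoˡ-≤ h (m/n*n≤m n (suc h))) ⟩
    n + n * h                          ≡⟨ *-suc n h ⟨
    n * suc h                          ∎))
    where
    open ≤-Reasoning
    q = n / suc h
    expand : ∀ w q h → (w + q) * h * suc h ≡ w * (h * suc h) + q * suc h * h
    expand = solve-∀

  Σ<-telescope : ∀ {n} (w : ℕ → ℕ) M .{{_ : NonZero M}} →
                 (∀ i → w i * (suc (M + i) * suc (M + i)) ≤ n) → ∀ k → Σ< k w * M ≤ n
  Σ<-telescope {n} w M@(suc m) w≤ k =
    ≤-trans (*-monoˡ-≤ M (≤-trans (m≤m+n (Σ< k w) (n / (M + k))) (sums k))) (m/n*n≤m n M)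
    where
    open ≤-Reasoning
    -- The tail n / (M + k) stays on the left, which makes each step a single `telescope-step`.
    sums : ∀ k → Σ< k w + n / (M + k) ≤ n / M
    sums zero = ≤-reflexive (cong (λ j → n / suc j) (+-identityʳ m))
    sums (suc k) = begin
      Σ< k w + w k + n / (M + suc k)    ≡⟨ +-assoc (Σ< k w) (w k) _ ⟩
      Σ< k w + (w k + n / (M + suc k))  ≡⟨ cong (λ j → Σ< k w + (w k + n / suc j)) (+-suc m k) ⟩
      Σ< k w + (w k + n / suc (M + k))  ≤⟨ +-monoʳ-≤ (Σ< k w) (telescope-step (M + k) (w≤ k)) ⟩
      Σ< k w + n / (M + k)              ≤⟨ sums k ⟩
      n / M                             ∎

  -- `f` divides both gcd (s , u) s and gcd (s , u) v, the latter because it divides s v and u v;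
  -- hence it divides their gcd.
  ∣gcd*gcd : ∀ {f s} u v → f ∣ s → f ∣ u * v → f ∣ gcd s u * gcd s v
  ∣gcd*gcd {f} {s} u v f∣s f∣uv = subst (f ∣_) (sym (c*gcd[m,n]≡gcd[cm,cn] (gcd s u) s v))
    (gcd-greatest (∣n⇒∣m*n (gcd s u) f∣s)
      (subst (f ∣_) (trans (sym (c*gcd[m,n]≡gcd[cm,cn] v s u)) (*-comm v (gcd s u)))
        (gcd-greatest (∣n⇒∣m*n v f∣s) (subst (f ∣_) (*-comm u v) f∣uv))))

  -- Three ways in which the pair (v , s) is confined to a sparse set; each contributes one summand
  -- of `pivotBound`.
  data Pivot (M v s : ℕ) : Set where
    commonDivisor : ∀ g → M < g → g ∣ v → g ∣ s → Pivot M v s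
    squareDivisor : ∀ r → M < r → r * r ∣ s → Pivot M v s
    small         : s ≤ M ^ 5 → Pivot M v s

  pivot : ∀ M {s x y z} A → 0 < s → s * (x * (y * z)) ≡ A * A →
          Pivot M x s ⊎ Pivot M y s ⊎ Pivot M z s
  pivot M {s} {x} {y} {z} A 0<s eq with square-split s (x * (y * z)) A 0<s eq
  ... | f , r , t , s≡ , xyz≡ with M <? r
  -- A large square divisor, like a small `s`, concerns `s` alone, so `x` is picked arbitrarily.
  ... | yes M<r = inj₁ (squareDivisor r M<r (subst (r * r ∣_) (sym s≡) (n∣m*n f)))
  ... | no M≮r with M <? gcd s x | M <? gcd s y | M <? gcd s z
  ... | yes M<g | _ | _ = inj₁ (commonDivisor _ M<g (gcd[m,n]∣n s x) (gcd[m,n]∣m s x))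
  ... | no _ | yes M<g | _ = inj₂ (inj₁ (commonDivisor _ M<g (gcd[m,n]∣n s y) (gcd[m,n]∣m s y)))
  ... | no _ | no _ | yes M<g = inj₂ (inj₂ (commonDivisor _ M<g (gcd[m,n]∣n s z) (gcd[m,n]∣m s z)))
  ... | no ≮x | no ≮y | no ≮z = inj₁ (small (subst₂ _≤_ (sym s≡) (fifth M)
    (*-mono-≤ (≤-trans (∣⇒≤ {{>-nonZero 0<gcds}} f∣gcds) gcds≤) (*-mono-≤ (≮⇒≥ M≮r) (≮⇒≥ M≮r)))))
    where
    fifth : ∀ M → M * (M * M) * (M * M) ≡ M * (M * (M * (M * (M * 1))))
    fifth = solve-∀
    f∣s : f ∣ s
    f∣s = subst (f ∣_) (sym s≡) (m∣m*n (r * r))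
    f∣gcds : f ∣ gcd s x * (gcd s y * gcd s z)
    f∣gcds = ∣-trans (∣gcd*gcd x (y * z) f∣s (subst (f ∣_) (sym xyz≡) (m∣m*n (t * t))))
      (*-monoʳ-∣ (gcd s x) (∣gcd*gcd y z (gcd[m,n]∣m s (y * z)) (gcd[m,n]∣n s (y * z))))
    gcds≤ : gcd s x * (gcd s y * gcd s z) ≤ M * (M * M)
    gcds≤ = *-mono-≤ (≮⇒≥ ≮x) (*-mono-≤ (≮⇒≥ ≮y) (≮⇒≥ ≮z))
    0<gcd : ∀ v → 0 < gcd s v
    0<gcd v = n≢0⇒n>0 (gcd[m,n]≢0 s v (inj₁ (≢-sym (<⇒≢ 0<s))))
    0<gcds : 0 < gcd s x * (gcd s y * gcd s z)
    0<gcds = *-mono-≤ (0<gcd x) (*-mono-≤ (0<gcd y) (0<gcd z))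

  -- A Heron triangle in the coordinates (s − a , s − b , s − c), with s ≤ W.
  record HeronPoint (W x y z : ℕ) : Set where
    constructor heronPoint
    field
      0<x    : 0 < x
      0<y    : 0 < y
      0<z    : 0 < z
      ≤W     : x + y + z ≤ W
      root   : ℕ
      square : (x + y + z) * (x * (y * z)) ≡ root * root

  Triple : Set
  Triple = ℕ × ℕ × ℕ

  AtMost-map : ∀ {P Q : Triple → Set} {n} (f : Triple → Triple) → (∀ {x y} → f x ≡ f y → x ≡ y) →
               (∀ {x} → P x → Q (f x)) → AtMost n Q → AtMost n P
  AtMost-map f f-injective P⇒Q = AtMost-~ {_~_ = λ x y → f x ≡ y}
    (λ p → _ , P⇒Q p , refl) (λ fx≡z fy≡z → f-injective (trans fx≡z (sym fy≡z)))

  -- The bound of `AtMost-SplitsInto`: how many pairs (y , z) can complete a given `x` and s.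
  fibreBound : ℕ → ℕ
  fibreBound T = T * (T * (T * (T * 3)))

  multiple : ∀ {d v N} .{{_ : NonZero d}} → 0 < v → v ≤ N → d ∣ v →
             ∃[ u ] (u < N / d × v ≡ suc u * d)
  multiple {d} 0<v v≤N (divides zero    refl) = contradiction 0<v λ ()
  multiple {d} 0<v v≤N (divides (suc u) refl) = u , *≤⇒≤/ d v≤N , refl

  module PivotCount (W T M : ℕ) .{{_ : NonZero M}} where

    -- The common divisor or square root runs through M + 1 + i. In the first case `x` and s are
    -- both multiples of it; in the second `x` is free and s is a multiple of its square.
    gcdTerm squareTerm : ℕ → ℕ
    gcdTerm i = W / suc (M + i) * (W / suc (M + i) * fibreBound T)
    squareTerm i = W * (W / (suc (M + i) * suc (M + i)) * fibreBound T)

    pivotBound : ℕ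
    pivotBound = Σ< W gcdTerm + (Σ< W squareTerm + M ^ 5 * (M ^ 5 * fibreBound T))

    -- The i-th term of either sum is at most W² `fibreBound T` / (M + 1 + i)², so each sum
    -- telescopes to a saving of `M`.
    pivotBound*M≤ : pivotBound * M ≤ W * W * fibreBound T + (W * W * fibreBound T + M ^ 5 * (M ^ 5 * fibreBound T) * M)
    pivotBound*M≤ = begin
      pivotBound * M
        ≡⟨ distrib (Σ< W gcdTerm) (Σ< W squareTerm) _ M ⟩
      Σ< W gcdTerm * M + (Σ< W squareTerm * M + M ^ 5 * (M ^ 5 * fibreBound T) * M)
        ≤⟨ +-mono-≤ (Σ<-telescope gcdTerm M gcd≤ W)
             (+-monoˡ-≤ _ (Σ<-telescope squareTerm M square≤ W)) ⟩
      W * W * fibreBound T + (W * W * fibreBound T + M ^ 5 * (M ^ 5 * fibreBound T) * M) ∎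
      where
      open ≤-Reasoning
      distrib : ∀ a b c m → (a + (b + c)) * m ≡ a * m + (b * m + c * m)
      distrib = solve-∀
      gcd≤ : ∀ i → gcdTerm i * (suc (M + i) * suc (M + i)) ≤ W * W * fibreBound T
      gcd≤ i = begin
        gcdTerm i * (g * g)                      ≡⟨ regroup (W / g) (fibreBound T) g ⟩
        (W / g * g) * (W / g * g) * fibreBound T   ≤⟨ *-monoˡ-≤ (fibreBound T) (*-mono-≤ (m/n*n≤m W g) (m/n*n≤m W g)) ⟩
        W * W * fibreBound T                       ∎
        where
        g = suc (M + i)
        regroup : ∀ q b g → q * (q * b) * (g * g) ≡ (q * g) * (q * g) * b
        regroup = solve-∀
      square≤ : ∀ i → squareTerm i * (suc (M + i) * suc (M + i)) ≤ W * W * fibreBound T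
      square≤ i = begin
        squareTerm i * g²                  ≡⟨ regroup W (W / g²) (fibreBound T) g² ⟩
        W * (W / g² * g²) * fibreBound T     ≤⟨ *-monoˡ-≤ (fibreBound T) (*-monoʳ-≤ W (m/n*n≤m W g²)) ⟩
        W * W * fibreBound T                 ∎
        where
        g² = suc (M + i) * suc (M + i)
        regroup : ∀ w q b g → w * (q * b) * g ≡ w * (q * g) * b
        regroup = solve-∀

    Pivoted : Triple → Set
    Pivoted (x , y , z) = HeronPoint W x y z × Pivot M x (x + y + z)

    above : ∀ {g} → M < g → ∃[ i ] (g ≡ suc (M + i))
    above {g} M<g = g ∸ suc M , sym (m+[n∸m]≡n M<g)

    module Cases {x y z} (h : HeronPoint W x y z) where
      open HeronPoint h
      x≤s : x ≤ x + y + z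
      x≤s = ≤-trans (m≤m+n x y) (m≤m+n (x + y) z)
      0<s : 0 < x + y + z
      0<s = ≤-trans 0<x x≤s
      ≤N : ∀ {N} → x + y + z ≤ N → x ≤ N
      ≤N = ≤-trans x≤s

    module _ (τ≤T : ∀ n → 0 < n → n ≤ W * W * (W * W) → τ n ≤ T) where

      Fibre : ℕ → ℕ → Triple → Set
      Fibre v s (x , y , z) = HeronPoint W x y z × x ≡ v × x + y + z ≡ s

      -- A base point gives a = s - v as y₀ + z₀. The other points of the fibre then split this `a`
      -- with D = s v, and D a² ≤ W⁴ is the reason for the range of `τ≤T`.
      AtMost-Fibre : ∀ v s → AtMost (fibreBound T) (Fibre v s)
      AtMost-Fibre v s = AtMost-given λ { {_ , y₀ , z₀} (h₀ , refl , refl) →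
        let open HeronPoint h₀
            s   = v + y₀ + z₀
            a   = y₀ + z₀
            a≤W = ≤-trans (m≤n+m a v) (subst (_≤ W) (+-assoc v y₀ z₀) ≤W)
            v≤W = ≤-trans (m≤m+n v a) (subst (_≤ W) (+-assoc v y₀ z₀) ≤W)
            0<s = ≤-trans 0<x (≤-trans (m≤m+n v y₀) (m≤m+n (v + y₀) z₀))
            0<a = ≤-trans 0<y (m≤m+n y₀ z₀)
            1≤W = ≤-trans 0<a a≤W
        in  AtMost-~ {_~_ = λ (x , y , z) yz → x ≡ v × (y , z) ≡ yz}
              (λ {(x , y , z)} → λ { (h , refl , s≡) → (y , z) ,
                (HeronPoint.0<y h , HeronPoint.0<z h ,
                  +-cancelˡ-≡ v (y + z) a (trans (sym (+-assoc v y z)) (trans s≡ (+-assoc v y₀ z₀))) ,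
                  HeronPoint.root h ,
                  trans (*-assoc s v (y * z)) (subst (λ s → s * (v * (y * z)) ≡ HeronPoint.root h * HeronPoint.root h) s≡ (HeronPoint.square h))) ,
                refl , refl })
              (λ { (refl , refl) (refl , refl) → refl })
              (AtMost-SplitsInto {D = s * v} {a} τ≤T (*-mono-≤ 0<s 0<x) 0<a
                (≤-trans a≤W (≤-trans (m≤m*n W W {{>-nonZero 1≤W}}) (m≤m*n (W * W) (W * W) {{>-nonZero (*-mono-≤ 1≤W 1≤W)}})))
                (*-mono-≤ (*-mono-≤ ≤W v≤W) (*-mono-≤ a≤W a≤W))) }

      AtMost-Pivoted : AtMost pivotBound Pivoted
      AtMost-Pivoted = AtMost-⇒ cases
        (AtMost-⊎ (AtMost-Σ< gcdTerm (λ i → AtMost-< (W / suc (M + i)) λ u → AtMost-< (W / suc (M + i)) λ t →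
                    AtMost-Fibre (suc u * suc (M + i)) (suc t * suc (M + i))) W)
        (AtMost-⊎ (AtMost-Σ< squareTerm (λ i → AtMost-< W λ u → AtMost-< (W / (suc (M + i) * suc (M + i))) λ t →
                    AtMost-Fibre (suc u) (suc t * (suc (M + i) * suc (M + i)))) W)
                  (AtMost-< (M ^ 5) λ u → AtMost-< (M ^ 5) λ t → AtMost-Fibre (suc u) (suc t))))
        where
        cases : ∀ {x} → Pivoted x →
          (∃[ i ] (i < W × ∃[ u ] (u < W / suc (M + i) × ∃[ t ] (t < W / suc (M + i) ×
            Fibre (suc u * suc (M + i)) (suc t * suc (M + i)) x)))) ⊎
          (∃[ i ] (i < W × ∃[ u ] (u < W × ∃[ t ] (t < W / (suc (M + i) * suc (M + i)) ×
            Fibre (suc u) (suc t * (suc (M + i) * suc (M + i))) x)))) ⊎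
          (∃[ u ] (u < M ^ 5 × ∃[ t ] (t < M ^ 5 × Fibre (suc u) (suc t) x)))
        cases {x , y , z} (h , commonDivisor g M<g g∣x g∣s) with above M<g
        ... | i , refl =
          let open HeronPoint h
              open Cases h
              u , u< , x≡ = multiple 0<x (≤N ≤W) g∣x
              t , t< , s≡ = multiple 0<s ≤W g∣s
          -- The index stays below `W` because the divisor M + 1 + i is at most s ≤ W.
          in  inj₁ (i , ≤-trans (s≤s (m≤n+m i M)) (≤-trans (∣⇒≤ {{>-nonZero 0<s}} g∣s) ≤W) ,
                    u , u< , t , t< , h , x≡ , s≡)
        cases {x , y , z} (h , squareDivisor r M<r r²∣s) with above M<r
        ... | i , refl =
          let open HeronPoint h
              open Cases h
              t , t< , s≡ = multiple 0<s ≤W r²∣s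
              -- The divisor 1 serves only to write `x` as a successor with `u` below `W`.
              u , u< , x≡ = multiple {1} 0<x (≤N ≤W) (1∣ x)
          in  inj₂ (inj₁ (i , ≤-trans (s≤s (m≤n+m i M)) (≤-trans (m≤m*n (suc (M + i)) (suc (M + i)))
                      (≤-trans (∣⇒≤ {{>-nonZero 0<s}} r²∣s) ≤W)) ,
                    u , subst (u <_) (n/1≡n W) u< , t , t< , h , trans x≡ (*-identityʳ _) , s≡))
        cases {x , y , z} (h , small s≤M⁵) =
          let open HeronPoint h
              open Cases h
              u , u< , x≡ = multiple {1} 0<x (≤N s≤M⁵) (1∣ x)
              t , t< , s≡ = multiple {1} 0<s s≤M⁵ (1∣ (x + y + z))
          in  inj₂ (inj₂ (u , subst (u <_) (n/1≡n (M ^ 5)) u< , t , subst (t <_) (n/1≡n (M ^ 5)) t< ,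
                    h , trans x≡ (*-identityʳ _) , trans s≡ (*-identityʳ _)))

      -- The equation is symmetric, so the coordinate singled out by `pivot` can be moved to the
      -- front; the three positions give three copies of the bound.
      AtMost-HeronPoint : AtMost (pivotBound + (pivotBound + pivotBound)) (λ (x , y , z) → HeronPoint W x y z)
      AtMost-HeronPoint = AtMost-⇒ choose
        (AtMost-⊎ AtMost-Pivoted (AtMost-⊎
          (AtMost-map (λ (x , y , z) → y , x , z) (λ { refl → refl }) (λ p → p) AtMost-Pivoted)
          (AtMost-map (λ (x , y , z) → z , x , y) (λ { refl → refl }) (λ p → p) AtMost-Pivoted)))
        where
        choose : ∀ {t : Triple} → (let (x , y , z) = t) → HeronPoint W x y z →
                 Pivoted (x , y , z) ⊎ Pivoted (y , x , z) ⊎ Pivoted (z , x , y)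
        choose {x , y , z} h@(heronPoint 0<x 0<y 0<z ≤W A sq)
          with pivot M A (Cases.0<s h) sq
        ... | inj₁ p = inj₁ (h , p)
        ... | inj₂ (inj₁ p) = inj₂ (inj₁
          (heronPoint 0<y 0<x 0<z (subst (_≤ W) s≡ ≤W) A (trans (cong₂ _*_ (sym s≡) (prod≡ x y z)) sq) ,
           subst (Pivot M y) s≡ p))
          where
          s≡ : x + y + z ≡ y + x + z
          s≡ = cong (_+ z) (+-comm x y)
          prod≡ : ∀ x y z → y * (x * z) ≡ x * (y * z)
          prod≡ = solve-∀
        ... | inj₂ (inj₂ p) = inj₂ (inj₂
          (heronPoint 0<z 0<x 0<y (subst (_≤ W) (s≡ x y z) ≤W) A
             (trans (cong₂ _*_ (sym (s≡ x y z)) (prod≡ x y z)) sq) ,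
           subst (Pivot M z) (s≡ x y z) p))
          where
          s≡ : ∀ x y z → x + y + z ≡ z + x + y
          s≡ = solve-∀
          prod≡ : ∀ x y z → z * (x * y) ≡ x * (y * z)
          prod≡ = solve-∀

-- From Heron triangles to Heron points.

module HeronTriangles where

  open Counting
  open HeronPoints
  open import Data.Nat
  open import Data.Nat.Properties
  open import Data.Nat.Divisibility
  open import Data.Nat.Primality using (euclidsLemma; prime[2])
  open import Data.Nat.Tactic.RingSolver using (solve-∀)
  open import Data.Nat.ListAction using (sum)
  open import Data.List using (List; []; _∷_; length; map; _++_; applyUpTo)
  open import Data.List.Properties using (length-++; length-map; map-cong)
  open import Data.List.Membership.Propositional using (_∈_)
  open import Data.List.Membership.Propositional.Properties using (∈-map⁻; ∈-++⁻; ∈-applyUpTo⁻)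
  open import Data.List.Relation.Unary.Any using (here; there)
  open import Data.List.Relation.Unary.All as All using (All; []; _∷_)
  open import Data.List.Relation.Unary.AllPairs using ([]; _∷_)
  open import Data.List.Relation.Unary.Unique.Propositional using (Unique)
  open import Data.List.Relation.Unary.Unique.Propositional.Properties using (map⁺; ++⁺; applyUpTo⁺₁)
  open import Data.Sum using (inj₁; inj₂; [_,_]′)
  open import Function using (_∘_)
  open import Function.Bundles using (Equivalence)
  open import Relation.Binary.PropositionalEquality

  module _ {A B : Set} where

    dependentPairs : List A → (A → List B) → List (A × B)
    dependentPairs []       f = []
    dependentPairs (x ∷ xs) f = map (x ,_) (f x) ++ dependentPairs xs f

    length-dependentPairs : ∀ xs f → length (dependentPairs xs f) ≡ sum (map (length ∘ f) xs)
    length-dependentPairs []       f = refl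
    length-dependentPairs (x ∷ xs) f = trans (length-++ (map (x ,_) (f x)))
      (cong₂ _+_ (length-map (x ,_) (f x)) (length-dependentPairs xs f))

    ∈-dependentPairs⁻ : ∀ xs {f a b} → (a , b) ∈ dependentPairs xs f → a ∈ xs × b ∈ f a
    ∈-dependentPairs⁻ (x ∷ xs) {f} ab∈ with ∈-++⁻ (map (x ,_) (f x)) ab∈
    ... | inj₂ ab∈xs = let a∈ , b∈ = ∈-dependentPairs⁻ xs ab∈xs in there a∈ , b∈
    ... | inj₁ ab∈x with ∈-map⁻ (x ,_) ab∈x
    ... | b , b∈ , refl = here refl , b∈

    dependentPairs-unique : ∀ {xs f} → Unique xs → (∀ a → Unique (f a)) → Unique (dependentPairs xs f)
    dependentPairs-unique []                    _  = []
    dependentPairs-unique {x ∷ xs} {f} (x∉ ∷ u) uf = ++⁺ (map⁺ (λ { refl → refl }) (uf x))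
      (dependentPairs-unique u uf) disjoint
      where
      disjoint : ∀ {p} → p ∈ map (x ,_) (f x) × p ∈ dependentPairs xs f → _
      disjoint (p∈x , p∈xs) with ∈-map⁻ (x ,_) p∈x
      ... | _ , _ , refl = All.lookup x∉ (proj₁ (∈-dependentPairs⁻ xs p∈xs)) refl

  -- The double sum is the length of one duplicate-free list of triples, to which `most` applies.
  heronSum≤ : ∀ {x N} → AtMost N (λ (a , b , c) → a ≤ x × b ≤ x × IsHeron a b c) → heronSum x ≤ N
  heronSum≤ {x} {N} most = subst (_≤ N) length-triples
    (most triples (dependentPairs-unique unique λ a → dependentPairs-unique unique (heronThirdSides-unique a))
      (All.tabulate member))
    where
    sides : List ℕ
    sides = applyUpTo suc x
    triples : List Triple
    triples = dependentPairs sides λ a → dependentPairs sides (heronThirdSides a)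
    unique : Unique sides
    unique = applyUpTo⁺₁ suc x λ i<j _ → <⇒≢ (s≤s i<j)
    length-triples : length triples ≡ heronSum x
    length-triples = trans (length-dependentPairs sides _)
      (cong sum (map-cong (λ a → length-dependentPairs sides (heronThirdSides a)) sides))
    ∈sides⇒≤ : ∀ {a} → a ∈ sides → a ≤ x
    ∈sides⇒≤ a∈ with ∈-applyUpTo⁻ suc a∈
    ... | _ , i<x , refl = i<x
    member : ∀ {t} → t ∈ triples → (let (a , b , c) = t) → a ≤ x × b ≤ x × IsHeron a b c
    member {a , b , c} t∈ =
      let a∈ , bc∈ = ∈-dependentPairs⁻ sides t∈
          b∈ , c∈ = ∈-dependentPairs⁻ sides bc∈
      in  ∈sides⇒≤ a∈ , ∈sides⇒≤ b∈ , Equivalence.to (∈-heronThirdSides a b c) c∈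

  2∣a+a : ∀ a → 2 ∣ a + a
  2∣a+a a = divides a (double a)
    where
    double : ∀ a → a + a ≡ a * 2
    double = solve-∀

  2∣+-double : ∀ {u t} a → u + (a + a) ≡ t → 2 ∣ u → 2 ∣ t
  2∣+-double a eq 2∣u = subst (2 ∣_) eq (∣m∣n⇒∣m+n 2∣u (2∣a+a a))

  2∣+-double⁻ : ∀ {u t} a → u + (a + a) ≡ t → 2 ∣ t → 2 ∣ u
  2∣+-double⁻ {u} a eq 2∣t = ∣m+n∣m⇒∣n (subst (2 ∣_) (trans (sym eq) (+-comm u (a + a))) 2∣t) (2∣a+a a)

  -- All four factors have the parity of `t`, and 2 is prime and divides their product.
  even-factor : ∀ {t u v w} a b c A → u + (a + a) ≡ t → v + (b + b) ≡ t → w + (c + c) ≡ t →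
                16 * (A * A) ≡ t * u * v * w → 2 ∣ t
  even-factor {t} {u} {v} {w} a b c A u+2a≡t v+2b≡t w+2c≡t area =
    [ [ [ (λ 2∣t → 2∣t) , 2∣+-double a u+2a≡t ]′ ∘ euclidsLemma t u prime[2] ,
        2∣+-double b v+2b≡t ]′ ∘ euclidsLemma (t * u) v prime[2] ,
      2∣+-double c w+2c≡t ]′
    (euclidsLemma (t * u * v) w prime[2] (subst (2 ∣_) area (∣m⇒∣m*n (A * A) (divides 8 refl))))

  0<half : ∀ {m} → 0 < m * 2 → 0 < m
  0<half {suc m} _ = z<s

  -- `u`, `v`, `w` stand for b + c - a, a + c - b, a + b - c, described by additions to keep
  -- truncated subtraction out. They and `t` are even, and halving all four cancels the 16.
  halfPerimeter : ∀ {n a b c t} u v w A → 0 < u → 0 < v → 0 < w →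
    u + a ≡ b + c → v + b ≡ a + c → w + c ≡ a + b → t ≡ a + b + c →
    16 * (A * A) ≡ t * u * v * w → a + b ≤ n →
    ∃[ x ] ∃[ y ] ∃[ z ] (HeronPoint n x y z × a ≡ y + z × b ≡ x + z × c ≡ x + y)
  halfPerimeter {n} {a} {b} {c} {t} u v w A 0<u 0<v 0<w u≡ v≡ w≡ t≡ area a+b≤n =
    conclude (2∣+-double⁻ a u+2a≡t 2∣t) (2∣+-double⁻ b v+2b≡t 2∣t) (2∣+-double⁻ c w+2c≡t 2∣t)
    where
    u+2a≡t : u + (a + a) ≡ t
    u+2a≡t = trans (sym (+-assoc u a a)) (trans (cong (_+ a) u≡) (trans (rotate a b c) (sym t≡)))
      where
      rotate : ∀ a b c → b + c + a ≡ a + b + c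
      rotate = solve-∀
    v+2b≡t : v + (b + b) ≡ t
    v+2b≡t = trans (sym (+-assoc v b b)) (trans (cong (_+ b) v≡) (trans (rotate a b c) (sym t≡)))
      where
      rotate : ∀ a b c → a + c + b ≡ a + b + c
      rotate = solve-∀
    w+2c≡t : w + (c + c) ≡ t
    w+2c≡t = trans (sym (+-assoc w c c)) (trans (cong (_+ c) w≡) (sym t≡))
    2∣t : 2 ∣ t
    2∣t = even-factor a b c A u+2a≡t v+2b≡t w+2c≡t area

    isolate : ∀ {a b c} y z → y * 2 + b ≡ a + c → z * 2 + c ≡ a + b → a ≡ y + z
    isolate {a} {b} {c} y z y≡ z≡ = *-cancelʳ-≡ a (y + z) 2 (+-cancelʳ-≡ (b + c) _ _
      (trans (left a b c) (trans (sym (cong₂ _+_ y≡ z≡)) (right y z b c))))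
      where
      left : ∀ a b c → a * 2 + (b + c) ≡ (a + c) + (a + b)
      left = solve-∀
      right : ∀ y z b c → (y * 2 + b) + (z * 2 + c) ≡ (y + z) * 2 + (b + c)
      right = solve-∀

    conclude : 2 ∣ u → 2 ∣ v → 2 ∣ w →
      ∃[ x ] ∃[ y ] ∃[ z ] (HeronPoint n x y z × a ≡ y + z × b ≡ x + z × c ≡ x + y)
    conclude (divides x u≡2x) (divides y v≡2y) (divides z w≡2z) =
      x , y , z ,
      heronPoint (0<half (subst (0 <_) u≡2x 0<u)) (0<half (subst (0 <_) v≡2y 0<v)) (0<half (subst (0 <_) w≡2z 0<w))
        -- The half perimeter satisfies x + y + z ≤ x + y + 2z = a + b.
        (≤-trans (≤-trans (m≤m+n (x + y + z) z) (≤-reflexive (trans (regroup x y z) (cong₂ _+_ (sym a≡) (sym b≡))))) a+b≤n)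
        A square ,
      a≡ , b≡ , c≡
      where
      a≡ : a ≡ y + z
      a≡ = isolate y z (subst (λ v → v + b ≡ a + c) v≡2y v≡) (subst (λ w → w + c ≡ a + b) w≡2z w≡)
      b≡ : b ≡ x + z
      b≡ = isolate x z (subst (λ u → u + a ≡ b + c) u≡2x u≡)
             (trans (subst (λ w → w + c ≡ a + b) w≡2z w≡) (+-comm a b))
      c≡ : c ≡ x + y
      c≡ = isolate x y (trans (subst (λ u → u + a ≡ b + c) u≡2x u≡) (+-comm b c))
             (trans (subst (λ v → v + b ≡ a + c) v≡2y v≡) (+-comm a c))
      regroup : ∀ x y z → x + y + z + z ≡ (y + z) + (x + z)
      regroup = solve-∀
      t≡2s : t ≡ (x + y + z) * 2
      t≡2s = trans t≡ (trans (cong₂ _+_ (cong₂ _+_ a≡ b≡) c≡) (double x y z))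
        where
        double : ∀ x y z → (y + z) + (x + z) + (x + y) ≡ (x + y + z) * 2
        double = solve-∀
      square : (x + y + z) * (x * (y * z)) ≡ A * A
      square = *-cancelˡ-≡ _ _ 16 (sym (trans area (trans
        (cong₂ _*_ (cong₂ _*_ (cong₂ _*_ t≡2s u≡2x) v≡2y) w≡2z) (collect (x + y + z) x y z))))
        where
        collect : ∀ s x y z → (s * 2) * (x * 2) * (y * 2) * (z * 2) ≡ 16 * (s * (x * (y * z)))
        collect s x y z = trans (gather s x y z 2) (*-comm (s * (x * (y * z))) 16)
          where
          gather : ∀ s x y z k → (s * k) * (x * k) * (y * k) * (z * k) ≡ s * (x * (y * z)) * (k * k * (k * k))
          gather = solve-∀

  heronCoordinates : ∀ {a b c x} → IsHeron a b c → a ≤ x → b ≤ x →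
    ∃[ X ] ∃[ Y ] ∃[ Z ] (HeronPoint (x + x) X Y Z × a ≡ Y + Z × b ≡ X + Z × c ≡ X + Y)
  heronCoordinates {a} {b} {c} (mkIsHeron _ _ _ a<b+c b<a+c c<a+b (A , _ , area)) a≤x b≤x =
    halfPerimeter (b + c ∸ a) (a + c ∸ b) (a + b ∸ c) A
      (m<n⇒0<n∸m a<b+c) (m<n⇒0<n∸m b<a+c) (m<n⇒0<n∸m c<a+b)
      (m∸n+n≡m (<⇒≤ a<b+c)) (m∸n+n≡m (<⇒≤ b<a+c)) (m∸n+n≡m (<⇒≤ c<a+b)) refl area
      (+-mono-≤ a≤x b≤x)

  -- The sides are sums of the coordinates, so distinct triangles have distinct coordinates.
  AtMost-IsHeron : ∀ {x N} → AtMost N (λ (X , Y , Z) → HeronPoint (x + x) X Y Z) →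
                   AtMost N (λ (a , b , c) → a ≤ x × b ≤ x × IsHeron a b c)
  AtMost-IsHeron {x} = AtMost-~ {_~_ = Sides} coordinates (λ {_} {_} {p} → unique {p = p})
    where
    Sides : Triple → Triple → Set
    Sides (a , b , c) (X , Y , Z) = a ≡ Y + Z × b ≡ X + Z × c ≡ X + Y
    coordinates : ∀ {t : Triple} → (let (a , b , c) = t) → a ≤ x × b ≤ x × IsHeron a b c →
                  ∃[ p ] ((let (X , Y , Z) = p) → HeronPoint (x + x) X Y Z × Sides t p)
    coordinates {a , b , c} (a≤x , b≤x , h) = pack (heronCoordinates h a≤x b≤x)
      where
      pack : ∃[ X ] ∃[ Y ] ∃[ Z ] (HeronPoint (x + x) X Y Z × Sides (a , b , c) (X , Y , Z)) → _
      pack (X , Y , Z , p , eqs) = (X , Y , Z) , p , eqs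
    unique : ∀ {t t′ p} → Sides t p → Sides t′ p → t ≡ t′
    unique (refl , refl , refl) (refl , refl , refl) = refl

  heronSum≤HeronPoint : ∀ {x N} → AtMost N (λ (X , Y , Z) → HeronPoint (x + x) X Y Z) → heronSum x ≤ N
  heronSum≤HeronPoint {x} {N} most = heronSum≤ {x} {N} (AtMost-IsHeron {x} {N} most)

-- Choice of the parameters and the exponent 25/13.

module Exponents where

  open Counting
  open DivisorBound
  open HeronPoints
  open HeronTriangles
  open import Data.Nat
  open import Data.Nat.Properties
  open import Data.Nat.Tactic.RingSolver using (solve-∀)
  open import Relation.Binary.PropositionalEquality
  open import Relation.Nullary using (yes; no)

  ^-cancelˡ-≤ : ∀ k {m n} → m ^ suc k ≤ n ^ suc k → m ≤ n
  ^-cancelˡ-≤ k mᵏ≤nᵏ = ≮⇒≥ λ n<m → <⇒≱ (^-monoˡ-< (suc k) n<m) mᵏ≤nᵏ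

  ^-cancelˡ-< : ∀ k {m n} → m ^ k < n ^ k → m < n
  ^-cancelˡ-< k mᵏ<nᵏ = ≰⇒> λ n≤m → <⇒≱ mᵏ<nᵏ (^-monoˡ-≤ k n≤m)

  -- Supplies `M` as the sixth root of x and `T` as a root of C B, both rounded down. Passing from n
  -- to n + 1 raises the root by at most one.
  integerRoot : ∀ k n → ∃[ r ] (r ^ suc k ≤ n × n < suc r ^ suc k)
  integerRoot k zero = 0 , z≤n , m^n>0 1 (suc k)
  integerRoot k (suc n) with integerRoot k n
  ... | r , rᵏ≤n , n<[1+r]ᵏ with suc r ^ suc k ≤? suc n
  ... | yes ≤n = suc r , ≤n , ≤-<-trans n<[1+r]ᵏ (^-monoˡ-< (suc k) (n<1+n (suc r)))
  ... | no  ≰n = r , m≤n⇒m≤1+n rᵏ≤n , ≰⇒> ≰n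

  -- The main term W² / M has order M ^ 11. The 9 comes from three pivot positions and the 3 in
  -- `fibreBound`; 2 w² + 1 adds up the common divisor, square and small cases.
  heronSum-bound : ∀ {x T} w M .{{_ : NonZero M}} →
    (∀ n → 0 < n → n ≤ (x + x) * (x + x) * ((x + x) * (x + x)) → τ n ≤ T) →
    x + x ≤ w * M ^ 6 → heronSum x ≤ 9 * (2 * (w * w) + 1) * (M ^ 11 * T ^ 4)
  heronSum-bound {x} {T} w M τ≤T W≤ = *-cancelʳ-≤ _ _ M (begin
    heronSum x * M                                 ≤⟨ *-monoˡ-≤ M (heronSum≤HeronPoint {x} (AtMost-HeronPoint τ≤T)) ⟩
    (b + (b + b)) * M                              ≡⟨ distrib b M ⟩
    3 * (b * M)                                    ≤⟨ *-monoʳ-≤ 3 pivotBound*M≤ ⟩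
    -- The last term is enlarged by a factor `M`, so that after W ≤ w M ^ 6 every term carries M ^
    -- 12.
    3 * (W * W * F + (W * W * F + P * (P * F) * M)) ≤⟨ *-monoʳ-≤ 3 (+-mono-≤ W²F≤ (+-mono-≤ W²F≤
                                                        (m≤m*n (P * (P * F) * M) M))) ⟩
    3 * (w * M ^ 6 * (w * M ^ 6) * F + (w * M ^ 6 * (w * M ^ 6) * F + P * (P * F) * M * M))
      ≡⟨ cong (λ F → 3 * (w * (M * P) * (w * (M * P)) * F + (w * (M * P) * (w * (M * P)) * F + P * (P * F) * M * M))) (F≡ T) ⟩
    3 * (w * (M * P) * (w * (M * P)) * (T ^ 4 * 3) +
      (w * (M * P) * (w * (M * P)) * (T ^ 4 * 3) + P * (P * (T ^ 4 * 3)) * M * M))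
                                                   ≡⟨ collect w M P (T ^ 4) ⟩
    9 * (2 * (w * w) + 1) * (P * P * M * T ^ 4) * M
      ≡⟨ cong (λ N → 9 * (2 * (w * w) + 1) * (N * T ^ 4) * M) P²M≡ ⟩
    9 * (2 * (w * w) + 1) * (M ^ 11 * T ^ 4) * M   ∎)
    where
    open ≤-Reasoning
    W = x + x
    open PivotCount W T M
    b = pivotBound
    F = fibreBound T
    P = M ^ 5
    W²F≤ : W * W * F ≤ w * M ^ 6 * (w * M ^ 6) * F
    W²F≤ = *-monoˡ-≤ F (*-mono-≤ W≤ W≤)
    distrib : ∀ b m → (b + (b + b)) * m ≡ 3 * (b * m)
    distrib = solve-∀
    F≡ : ∀ T → T * (T * (T * (T * 3))) ≡ T * (T * (T * (T * 1))) * 3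
    F≡ = solve-∀
    P²M≡ : P * P * M ≡ M ^ 11
    P²M≡ = trans (*-comm (P * P) M) (cong (M *_) (sym (^-distribˡ-+-* M 5 5)))
    collect : ∀ w M P t →
      3 * (w * (M * P) * (w * (M * P)) * (t * 3) +
        (w * (M * P) * (w * (M * P)) * (t * 3) + P * (P * (t * 3)) * M * M)) ≡
      9 * (2 * (w * w) + 1) * (P * P * M * t) * M
    collect = solve-∀

  -- 11 · 13 + 6 = 149 < 150 = 6 · 25, and T⁵² comes from (T⁴)¹³.
  power-bound : ∀ {S x} c D M T → S ≤ c * (M ^ 11 * T ^ 4) → T ^ 52 ≤ D * M ^ 6 →
                c ^ 13 * D < M → M ^ 6 ≤ x → S ^ 13 < x ^ 25
  power-bound {S} {x} c D M T S≤ T⁵²≤ <M M⁶≤x = begin-strict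
    S ^ 13                             ≤⟨ ^-monoˡ-≤ 13 S≤ ⟩
    (c * (M ^ 11 * T ^ 4)) ^ 13        ≡⟨ ^-distribʳ-* 13 c _ ⟩
    c ^ 13 * (M ^ 11 * T ^ 4) ^ 13     ≡⟨ cong (c ^ 13 *_) (^-distribʳ-* 13 (M ^ 11) (T ^ 4)) ⟩
    c ^ 13 * ((M ^ 11) ^ 13 * (T ^ 4) ^ 13)
      ≡⟨ cong (c ^ 13 *_) (cong₂ _*_ (^-*-assoc M 11 13) (^-*-assoc T 4 13)) ⟩
    c ^ 13 * (M ^ 143 * T ^ 52)        ≤⟨ *-monoʳ-≤ (c ^ 13) (*-monoʳ-≤ (M ^ 143) T⁵²≤) ⟩
    c ^ 13 * (M ^ 143 * (D * M ^ 6))   ≡⟨ regroup (c ^ 13) (M ^ 143) D (M ^ 6) ⟩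
    c ^ 13 * D * (M ^ 143 * M ^ 6)     ≡⟨ cong (c ^ 13 * D *_) (sym (^-distribˡ-+-* M 143 6)) ⟩
    c ^ 13 * D * M ^ 149               <⟨ *-monoˡ-< (M ^ 149) {{m^n≢0 M 149 {{M≢0}}}} <M ⟩
    M ^ 150                            ≡⟨ ^-*-assoc M 6 25 ⟨
    (M ^ 6) ^ 25                       ≤⟨ ^-monoˡ-≤ 25 M⁶≤x ⟩
    x ^ 25                             ∎
    where
    open ≤-Reasoning
    M≢0 : NonZero M
    M≢0 = >-nonZero (≤-<-trans z≤n <M)
    regroup : ∀ a b c d → a * (b * (c * d)) ≡ a * c * (b * d)
    regroup = solve-∀

  -- `T` is the rounded-down root of C B, so comparing powers gives τ n < T + 1.
  τ-uniform : ∀ k C → (∀ n → 0 < n → τ n ^ suc k ≤ C * n) →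
              ∀ B → ∃[ T ] (T ^ suc k ≤ C * B × (∀ n → 0 < n → n ≤ B → τ n ≤ T))
  τ-uniform k C τ≤ B with integerRoot k (C * B)
  ... | T , T≤ , <1+T = T , T≤ , λ n 0<n n≤B → ≤-pred
    (^-cancelˡ-< (suc k) (≤-<-trans (≤-trans (τ≤ n 0<n) (*-monoʳ-≤ C n≤B)) <1+T))

  -- 208 = 4 · 52; the four factors W, each of order M⁶, are absorbed by the fourth root.
  fourth-root-bound : ∀ C w T {W Q} → T ^ 208 ≤ C * (W * W * (W * W)) → W ≤ w * Q → T ^ 52 ≤ C * w * Q
  fourth-root-bound C w T {W} {Q} T≤ W≤ = ^-cancelˡ-≤ 3 (begin
    (T ^ 52) ^ 4                        ≡⟨ ^-*-assoc T 52 4 ⟩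
    T ^ 208                             ≤⟨ T≤ ⟩
    C * (W * W * (W * W))               ≤⟨ *-mono-≤ (m≤m^4 C) (*-mono-≤ (*-mono-≤ W≤ W≤) (*-mono-≤ W≤ W≤)) ⟩
    C ^ 4 * (w * Q * (w * Q) * (w * Q * (w * Q))) ≡⟨ regroup C w Q ⟩
    (C * w * Q) ^ 4                     ∎)
    where
    open ≤-Reasoning
    m≤m^4 : ∀ m → m ≤ m ^ 4
    m≤m^4 zero      = z≤n
    m≤m^4 m@(suc _) = m≤m*n m (m ^ 3) {{m^n≢0 m 3}}
    regroup : ∀ C w Q → C * (C * (C * (C * 1))) * (w * Q * (w * Q) * (w * Q * (w * Q))) ≡
      C * w * Q * (C * w * Q * (C * w * Q * (C * w * Q * 1)))
    regroup = solve-∀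

  -- Since M ≥ 1, x < (M + 1) ^ 6 ≤ (2 M) ^ 6.
  double≤ : ∀ M x .{{_ : NonZero M}} → x < suc M ^ 6 → x + x ≤ (2 ^ 6 + 2 ^ 6) * M ^ 6
  double≤ M x x< = subst (x + x ≤_) (sym (*-distribʳ-+ (M ^ 6) (2 ^ 6) (2 ^ 6))) (+-mono-≤ x≤ x≤)
    where
    open ≤-Reasoning
    x≤ : x ≤ 2 ^ 6 * M ^ 6
    x≤ = begin
      x             ≤⟨ <⇒≤ x< ⟩
      suc M ^ 6     ≤⟨ ^-monoˡ-≤ 6 (+-mono-≤ (>-nonZero⁻¹ M) (m≤m+n M 0)) ⟩
      (2 * M) ^ 6   ≡⟨ ^-distribʳ-* 6 2 M ⟩
      2 ^ 6 * M ^ 6 ∎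

  root-large : ∀ {E M x} → suc E ^ 6 ≤ x → x < suc M ^ 6 → E < M
  root-large E≤ <M = ≤-pred (^-cancelˡ-< 6 (≤-<-trans E≤ <M))

  heronSum^13< : ∀ C w → (∀ n → 0 < n → τ n ^ 208 ≤ C * n) →
                 (∀ M x .{{_ : NonZero M}} → x < suc M ^ 6 → x + x ≤ w * M ^ 6) →
                 ∃[ x₀ ] (∀ x → x₀ ≤ x → heronSum x ^ 13 < x ^ 25)
  -- The threshold is (E + 1) ^ 6 with E the product c ^ 13 D of `power-bound`; it forces E < M.
  heronSum^13< C w τ≤ double≤ = suc ((9 * (2 * (w * w) + 1)) ^ 13 * (C * w)) ^ 6 , bound
    where
    bound : ∀ x → suc ((9 * (2 * (w * w) + 1)) ^ 13 * (C * w)) ^ 6 ≤ x → heronSum x ^ 13 < x ^ 25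
    bound x x₀≤x = conclude (integerRoot 5 x) (τ-uniform 207 C τ≤ ((x + x) * (x + x) * ((x + x) * (x + x))))
      where
      conclude : ∃[ M ] (M ^ 6 ≤ x × x < suc M ^ 6) →
                 ∃[ T ] (T ^ 208 ≤ C * ((x + x) * (x + x) * ((x + x) * (x + x))) ×
                   (∀ n → 0 < n → n ≤ (x + x) * (x + x) * ((x + x) * (x + x)) → τ n ≤ T)) →
                 heronSum x ^ 13 < x ^ 25
      conclude (M , M⁶≤x , x<[1+M]⁶) (T , T≤ , τ≤T) = power-bound (9 * (2 * (w * w) + 1)) (C * w) M T
        (heronSum-bound {x} w M τ≤T W≤) (fourth-root-bound C w T T≤ W≤) E<M M⁶≤x
        where
        E<M = root-large x₀≤x x<[1+M]⁶
        instance
          M≢0 : NonZero M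
          M≢0 = >-nonZero (≤-<-trans z≤n E<M)
        W≤ : x + x ≤ w * M ^ 6
        W≤ = double≤ M x x<[1+M]⁶

  heronSum^13<x^25 : ∃[ x₀ ] (∀ x → x₀ ≤ x → heronSum x ^ 13 < x ^ 25)
  heronSum^13<x^25 = heronSum^13< (proj₁ (τ-bound 208)) (2 ^ 6 + 2 ^ 6) (proj₂ (τ-bound 208)) double≤

open import Data.Nat using (ℕ; _≤_; _<_)
open import Data.Integer using (+_)
open import Data.Rational.Unnormalised using (0ℚᵘ; _/_; _+_)

theorem3p1 : ∃[ o ] (TendsToZero o ×
    ∃[ x₀ ] (∀ (x : ℕ) → 0 < x → x₀ ≤ x → heronSum x < x ^ᵘ ((+ 25) / 13 + o x)))
-- With o = 0 the sum 25/13 + 0 evaluates to numerator 25 and denominator 13, so the goal unfolds to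
-- `heronSum x ^ 13 < x ^ 25`.
theorem3p1 = (λ _ → 0ℚᵘ) , (λ _ 0<ε → 0 , λ _ _ → 0<ε) ,
  proj₁ Exponents.heronSum^13<x^25 , λ x _ → proj₂ Exponents.heronSum^13<x^25 x
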